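{- There is a polynomial-time algorithm that, given normalised $\mathcal{ELH}^r$-terminologies $\mathcal{T}_1$ and $\mathcal{T}_2$ and a (finite) signature $\Sigma$, computes the set $\mathsf{qWtn}^{\mathsf{lhs}}_\Sigma(\mathcal{T}_1,\mathcal{T}_2)$, which consists of - all concept names $A\in\Sigma$ such that there exists a $\mathcal{C}^{\sqcap,u}$-concept $C$ with $(\{A(a)\},C(a))\in\mathsf{qDiff}_\Sigma(\mathcal{T}_1,\mathcal{T}_2)$, and - all role names $r\in\Sigma$ such that there exist a $\mathcal{C}^{\sqcap,u}$-concept $C$ and $c\in\{a,b\}$ with $(\{r(a,b)\},C(c))\in\mathsf{qDiff}_\Sigma(\mathcal{T}_1,\mathcal{T}_2)$, where $a,b$ are distinct individual names.
   Context: $\mathsf{N_C},\mathsf{N_R},\mathsf{N_I}$ are countably infinite, mutually disjoint sets of concept names, role names and individual names. $\mathcal{EL}$-concepts: $C ::= A \mid \top \mid C\sqcap D \mid \exists r.C$ with $A\in\mathsf{N_C}$, $r\in\mathsf{N_R}$. $\mathcal{ELH}^r$-inclusions are: concept inclusions $C\sqsubseteq D$, $\mathsf{ran}(r)\sqsubseteq D$, $\mathsf{ran}(r)\sqcap C\sqsubseteq D$; concept equations $C\equiv D$; role inclusions $r\sqsubseteq s$ (with $C,D$ $\mathcal{EL}$-concepts, $r,s\in\mathsf{N_R}$). An $\mathcal{ELH}^r$-TBox is a finite set of $\mathcal{ELH}^r$-inclusions. $\mathcal{C}^{\sqcap,u}$-concepts: $C ::= A\mid\top\mid C\sqcap D\mid\exists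 R.C\mid\exists u.C$, where $A\in\mathsf{N_C}$, $R=r_1\sqcap\cdots\sqcap r_n$ with $n\ge1$, $r_i\in\mathsf{N_R}$, and $u$ (the universal role) is a logical symbol not in $\mathsf{N_R}$ (it does not belong to any signature). Semantics: an interpretation $\mathcal{I}=(\Delta^{\mathcal I},\cdot^{\mathcal I})$ has a nonempty domain, $A^{\mathcal I}\subseteq\Delta^{\mathcal I}$, $r^{\mathcal I}\subseteq\Delta^{\mathcal I}\times\Delta^{\mathcal I}$, $a^{\mathcal I}\in\Delta^{\mathcal I}$; $\top^{\mathcal I}=\Delta^{\mathcal I}$, $(C\sqcap D)^{\mathcal I}=C^{\mathcal I}\cap D^{\mathcal I}$, $(r_1\sqcap\cdots\sqcap r_n)^{\mathcal I}=\bigcap_i r_i^{\mathcal I}$, $u^{\mathcal I}=\Delta^{\mathcal I}\times\Delta^{\mathcal I}$, $(\exists R.C)^{\mathcal I}=\{d\mid\exists e\in C^{\mathcal I}:(d,e)\in R^{\mathcal I}\}$, $\mathsf{ran}(r)^{\mathcal I}=\{d\mid\exists e:(e,d)\in r^{\mathcal I}\}$. Inclusions (equations) are satisfied if the corresponding set inclusion (equality) holds; $\mathcal I\models C(a)$ iff $a^{\mathcal I}\in C^{\mathcal I}$; $\mathcal I\models r(a,b)$ iff $(a^{\mathcal I},b^{\mathcal I})\in r^{\mathcal I}$. An $\mathcal{ELH}^r$-terminology is an $\mathcal{ELH}^r$-TBox all of whose concept inclusions and equations have the form $A\sqsubseteq C$, $A\equiv C$, $\mathsf{ran}(r)\sqsubseteq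 C$ or $\exists r.\top\sqsubseteq C$, with $A\in\mathsf{N_C}$, $C$ an $\mathcal{EL}$-concept with $C\neq\top$, $C\ne\top\sqcap\top$, etc., and in which no concept name occurs more than once on the left-hand side. A concept name $A$ is pseudo-primitive in $\mathcal T$ if there is no $A\equiv C\in\mathcal T$; it is non-conjunctive in $\mathcal T$ if it is pseudo-primitive in $\mathcal T$ or there is an $A\equiv\exists r.C\in\mathcal T$. The terminology is normalised if, apart from role inclusions, it consists of inclusions of the forms: $A\equiv\exists r.B$ or $A\equiv F$ ($A,B$ concept names, $F$ a nonempty conjunction of concept names non-conjunctive in $\mathcal T$); $E\sqsubseteq\exists r.B$, $E\sqsubseteq\exists r.\top$ or $E\sqsubseteq F$ ($B$ a concept name, $E$ a concept name or $\exists s.\top$ or $\mathsf{ran}(s)$, $F$ as before). An ABox is a nonempty finite set of assertions $\top(a)$, $A(a)$, $r(a,b)$. A conjunctive query is a first-order formula $q(\vec x)=\exists\vec y\,\psi(\vec x,\vec y)$ with $\psi$ a conjunction of atoms $A(t)$, $r(t_1,t_2)$ whose terms are individual names or variables from $\vec x,\vec y$. For a tuple $\vec a$ of individual names in $\mathcal A$, $(\mathcal T,\mathcal A)\models q(\vec a)$ means that $q(\vec a)$ is true (in the usual first-order sense) in every model of $\mathcal T$ and $\mathcal A$. An assertion $C(a)$ with $C$ a $\mathcal C^{\sqcap,u}$-concept is identified with the equivalent Boolean conjunctive query (e.g. $(\exists u.A\sqcap\exists r.B)(a)$ with $\exists x\exists y(A(x)\wedge r(a,y)\wedge B(y))$),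 so that $(\mathcal T,\mathcal A)\models C(a)$ means $a^{\mathcal I}\in C^{\mathcal I}$ in every model $\mathcal I$ of $\mathcal T$ and $\mathcal A$. A signature is a subset $\Sigma\subseteq\mathsf{N_C}\cup\mathsf{N_R}$; a $\Sigma$-object is one in which only concept and role names from $\Sigma$ occur. $\mathsf{qDiff}_\Sigma(\mathcal T_1,\mathcal T_2)$ is the set of pairs $(\mathcal A,q(\vec a))$ with $\mathcal A$ a $\Sigma$-ABox, $q(\vec x)$ a conjunctive $\Sigma$-query and $\vec a$ a tuple of individual names in $\mathcal A$ such that $(\mathcal T_1,\mathcal A)\models q(\vec a)$ and $(\mathcal T_2,\mathcal A)\not\models q(\vec a)$. -}

module Defs where

open import Level using (0ℓ; _⊔_)
open import Data.Bool.Base using (Bool; true; false)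
open import Data.Nat.Base using (ℕ; zero; suc; _+_; _*_; _^_; _≤_)
open import Data.Fin.Base using (Fin; zero; suc; _↑ˡ_; _↑ʳ_)
open import Data.List.Base using (List; []; _∷_; _++_; map; concatMap)
open import Data.List.NonEmpty.Base using (List⁺; toList) renaming ([_] to [_]⁺)
open import Data.List.Membership.Propositional using (_∈_)
open import Data.List.Relation.Unary.All using (All; []; _∷_)
import Data.List.Relation.Unary.All.Properties as All
open import Data.Maybe.Base using (Maybe; just; nothing)
open import Data.Product.Base using (Σ-syntax; ∃; ∃-syntax; _×_; _,_)
open import Data.Sum.Base using (_⊎_; inj₁; inj₂)
open import Data.Vec.Base using (Vec; []; _∷_; lookup)
import Data.Vec.Functional as Assignment
import Data.Vec.Functional.Properties as Assignmentₚ
import Data.Vec.Relation.Unary.All as Vec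
open import Function.Base using (_∘_; id)
open import Function.Bundles using (_⇔_; mk⇔)
open import Relation.Binary.Core using (Rel; _⇒_)
open import Relation.Binary.PropositionalEquality
  using (_≡_; refl; sym; trans; subst)
open import Relation.Nullary.Negation using (¬_)
open import Relation.Unary using (Pred; U; _∩_; _⊆_; _≐_)

infixr 7 _⊓_
infix  5 ran_⊓ᴸ_
infix  4 _⊑_ _≣_ _⊑ᴿ_

------------------------------------------------------------------------
-- Names.  The index keeps the three kinds of names disjoint.  Names are
-- binary words, so that they can be read by a program.

data Kind : Set where
  concept role individual : Kind

record Name (k : Kind) : Set where
  constructor name
  field word : List Bool

N_C N_R N_I : Set
N_C = Name concept
N_R = Name role
N_I = Name individual

Symbol : Set
Symbol = N_C ⊎ N_R

Signature : Set₁
Signature = Pred Symbol 0ℓ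

------------------------------------------------------------------------
-- Syntax

data EL : Set where
  atom : N_C → EL
  ⊤ᶜ   : EL
  _⊓_  : EL → EL → EL
  ∃ᶜ   : N_R → EL → EL

data LHS : Set where
  con     : EL → LHS
  ran     : N_R → LHS
  ran_⊓ᴸ_ : N_R → EL → LHS

data Inclusion : Set where
  _⊑_  : LHS → EL → Inclusion
  _≣_  : EL → EL → Inclusion
  _⊑ᴿ_ : N_R → N_R → Inclusion

-- Finite sets are lists of which only the membership relation matters.
TBox : Set
TBox = List Inclusion

-- A conjunction r₁ ⊓ ⋯ ⊓ rₙ (n ≥ 1) of role names is a nonempty list.
data C⊓u : Set where
  atom : N_C → C⊓u
  ⊤ᶜ   : C⊓u
  _⊓_  : C⊓u → C⊓u → C⊓u
  ∃ᶜ   : List⁺ N_R → C⊓u → C⊓u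
  ∃u   : C⊓u → C⊓u

data Assertion : Set where
  ⊤⟨_⟩   : N_I → Assertion
  _⟨_⟩   : N_C → N_I → Assertion
  _⟨_⨾_⟩ : N_R → N_I → N_I → Assertion

ABox : Set
ABox = List⁺ Assertion

-- Terms and atoms of a query with n answer variables and m quantified
-- variables.
data Term (n m : ℕ) : Set where
  ind : N_I → Term n m
  ans : Fin n → Term n m
  var : Fin m → Term n m

data Atom (n m : ℕ) : Set where
  _⟨_⟩   : N_C → Term n m → Atom n m
  _⟨_⨾_⟩ : N_R → Term n m → Term n m → Atom n m

-- The empty conjunction is the true query; it is what ⊤(a) amounts to.
record CQ (n : ℕ) : Set where
  constructor cq
  field
    {quantified} : ℕ
    atoms        : List (Atom n quantified)

------------------------------------------------------------------------
-- Semantics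

-- Domains are nonempty because individual names are interpreted in them.
record Interpretation : Set₁ where
  field
    Δ     : Set
    cname : N_C → Pred Δ 0ℓ
    rname : N_R → Rel Δ 0ℓ
    iname : N_I → Δ

module _ (I : Interpretation) where
  open Interpretation I

  ⟦_⟧ : EL → Pred Δ 0ℓ
  ⟦ atom A ⟧ = cname A
  ⟦ ⊤ᶜ ⟧     = U
  ⟦ C ⊓ D ⟧  = ⟦ C ⟧ ∩ ⟦ D ⟧
  ⟦ ∃ᶜ r C ⟧ = λ d → ∃[ e ] (rname r d e × ⟦ C ⟧ e)

  range : N_R → Pred Δ 0ℓ
  range r = λ d → ∃[ e ] rname r e d

  ⟦_⟧ᴸ : LHS → Pred Δ 0ℓ
  ⟦ con C ⟧ᴸ      = ⟦ C ⟧
  ⟦ ran r ⟧ᴸ      = range r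
  ⟦ ran r ⊓ᴸ C ⟧ᴸ = range r ∩ ⟦ C ⟧

  ⟦_⟧ᴿ : List⁺ N_R → Rel Δ 0ℓ
  ⟦ R ⟧ᴿ d e = All (λ r → rname r d e) (toList R)

  ⟦_⟧ᵘ : C⊓u → Pred Δ 0ℓ
  ⟦ atom A ⟧ᵘ = cname A
  ⟦ ⊤ᶜ ⟧ᵘ     = U
  ⟦ C ⊓ D ⟧ᵘ  = ⟦ C ⟧ᵘ ∩ ⟦ D ⟧ᵘ
  ⟦ ∃ᶜ R C ⟧ᵘ = λ d → ∃[ e ] (⟦ R ⟧ᴿ d e × ⟦ C ⟧ᵘ e)
  ⟦ ∃u C ⟧ᵘ   = λ d → ∃[ e ] ⟦ C ⟧ᵘ e

  SatInclusion : Inclusion → Set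
  SatInclusion (E ⊑ D)  = ⟦ E ⟧ᴸ ⊆ ⟦ D ⟧
  SatInclusion (C ≣ D)  = ⟦ C ⟧ ≐ ⟦ D ⟧
  SatInclusion (r ⊑ᴿ s) = rname r ⇒ rname s

  SatAssertion : Assertion → Set
  SatAssertion ⊤⟨ a ⟩        = U (iname a)
  SatAssertion (A ⟨ a ⟩)     = cname A (iname a)
  SatAssertion (r ⟨ a ⨾ b ⟩) = rname r (iname a) (iname b)

  module _ {n m : ℕ} (as : Vec N_I n) (σ : Fin m → Δ) where

    value : Term n m → Δ
    value (ind a) = iname a
    value (ans i) = iname (lookup as i)
    value (var y) = σ y

    SatAtom : Atom n m → Set
    SatAtom (A ⟨ t ⟩)       = cname A (value t)
    SatAtom (r ⟨ t₁ ⨾ t₂ ⟩) = rname r (value t₁) (value t₂)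

  SatCQ : ∀ {n} → CQ n → Vec N_I n → Set
  SatCQ (cq {m} ψ) as = ∃[ σ ] All (SatAtom {m = m} as σ) ψ

  SatTBox : TBox → Set
  SatTBox T = All SatInclusion T

  SatABox : ABox → Set
  SatABox A = All SatAssertion (toList A)

Entails : ∀ {n} → TBox → ABox → CQ n → Vec N_I n → Set₁
Entails T A q as = ∀ I → SatTBox I T → SatABox I A → SatCQ I q as

------------------------------------------------------------------------
-- C⊓u-assertions as Boolean conjunctive queries

#∃ : C⊓u → ℕ
#∃ (atom A) = 0
#∃ ⊤ᶜ       = 0
#∃ (C ⊓ D)  = #∃ C + #∃ D
#∃ (∃ᶜ R C) = suc (#∃ C)
#∃ (∃u C)   = suc (#∃ C)

-- ρ names the variables to be used for the existentials of the concept.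
unravel : ∀ {m} (C : C⊓u) → Term 0 m → (Fin (#∃ C) → Fin m) → List (Atom 0 m)
unravel (atom A) t ρ = A ⟨ t ⟩ ∷ []
unravel ⊤ᶜ       t ρ = []
unravel (C ⊓ D)  t ρ =
  unravel C t (ρ ∘ (_↑ˡ #∃ D)) ++ unravel D t (ρ ∘ (#∃ C ↑ʳ_))
unravel (∃ᶜ R C) t ρ =
  map (λ r → r ⟨ t ⨾ var (ρ zero) ⟩) (toList R)
    ++ unravel C (var (ρ zero)) (ρ ∘ suc)
unravel (∃u C)   t ρ = unravel C (var (ρ zero)) (ρ ∘ suc)

assertionQuery : C⊓u → N_I → CQ 0
assertionQuery C a = cq (unravel C (ind a) id)

module _ (I : Interpretation) where
  open Interpretation I

  private
    val : ∀ {m} → (Fin m → Δ) → Term 0 m → Δ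
    val = value I []

    sound : ∀ {m} C t (ρ : Fin (#∃ C) → Fin m) (σ : Fin m → Δ) →
            All (SatAtom I [] σ) (unravel C t ρ) → ⟦ I ⟧ᵘ C (val σ t)
    sound (atom A) t ρ σ (p ∷ []) = p
    sound ⊤ᶜ       t ρ σ p = _
    sound (C ⊓ D)  t ρ σ p
      with pC , pD ← All.++⁻ (unravel C t _) p =
      sound C t _ σ pC , sound D t _ σ pD
    sound (∃ᶜ R C) t ρ σ p
      with pR , pC ← All.++⁻ (map _ (toList R)) p =
      σ (ρ zero) , All.map⁻ pR , sound C _ _ σ pC
    sound (∃u C)   t ρ σ p = σ (ρ zero) , sound C _ _ σ p

    witness : ∀ C {d} → ⟦ I ⟧ᵘ C d → Fin (#∃ C) → Δ
    witness (C ⊓ D)  (p , q)     = witness C p Assignment.++ witness D q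
    witness (∃ᶜ R C) (e , _ , p) = e Assignment.∷ witness C p
    witness (∃u C)   (e , p)     = e Assignment.∷ witness C p

    complete : ∀ {m} C {d} (p : ⟦ I ⟧ᵘ C d) t (ρ : Fin (#∃ C) → Fin m) σ →
               val σ t ≡ d → (∀ i → σ (ρ i) ≡ witness C p i) →
               All (SatAtom I [] σ) (unravel C t ρ)
    complete (atom A) p t ρ σ refl eq = p ∷ []
    complete ⊤ᶜ       p t ρ σ refl eq = []
    complete (C ⊓ D) (p , q) t ρ σ refl eq = All.++⁺
      (complete C p t _ σ refl λ i →
        trans (eq _) (Assignmentₚ.lookup-++ˡ (witness C p) (witness D q) i))
      (complete D q t _ σ refl λ i →
        trans (eq _) (Assignmentₚ.lookup-++ʳ (witness C p) (witness D q) i))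
    complete (∃ᶜ R C) (e , pR , p) t ρ σ refl eq = All.++⁺
      (All.map⁺ (subst (λ x → ⟦ I ⟧ᴿ R (val σ t) x) (sym (eq zero)) pR))
      (complete C p _ _ σ (eq zero) (eq ∘ suc))
    complete (∃u C) (e , p) t ρ σ refl eq =
      complete C p _ _ σ (eq zero) (eq ∘ suc)

  assertionQuery-correct :
    ∀ C a → SatCQ I (assertionQuery C a) [] ⇔ ⟦ I ⟧ᵘ C (iname a)
  assertionQuery-correct C a = mk⇔
    (λ (σ , p) → sound C (ind a) id σ p)
    (λ p → witness C p , complete C p (ind a) id (witness C p) refl (λ _ → refl))

------------------------------------------------------------------------
-- Logical difference

symbolsA : Assertion → List Symbol
symbolsA ⊤⟨ a ⟩        = []
symbolsA (A ⟨ a ⟩)     = inj₁ A ∷ []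
symbolsA (r ⟨ a ⨾ b ⟩) = inj₂ r ∷ []

individualsA : Assertion → List N_I
individualsA ⊤⟨ a ⟩        = a ∷ []
individualsA (A ⟨ a ⟩)     = a ∷ []
individualsA (r ⟨ a ⨾ b ⟩) = a ∷ b ∷ []

symbolsQ : ∀ {n m} → Atom n m → List Symbol
symbolsQ (A ⟨ t ⟩)       = inj₁ A ∷ []
symbolsQ (r ⟨ t₁ ⨾ t₂ ⟩) = inj₂ r ∷ []

individuals : ABox → List N_I
individuals A = concatMap individualsA (toList A)

_IsABoxOver_ : ABox → Signature → Set
A IsABoxOver S = All S (concatMap symbolsA (toList A))

_IsQueryOver_ : ∀ {n} → CQ n → Signature → Set
q IsQueryOver S = All S (concatMap symbolsQ (CQ.atoms q))

record qDiff (S : Signature) (T₁ T₂ : TBox)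
             {n : ℕ} (A : ABox) (q : CQ n) (as : Vec N_I n) : Set₁ where
  field
    abox-over    : A IsABoxOver S
    query-over   : q IsQueryOver S
    tuple-in     : Vec.All (_∈ individuals A) as
    entailed     : Entails T₁ A q as
    not-entailed : ¬ Entails T₂ A q as

qWtnˡʰˢ : (a b : N_I) → Signature → TBox → TBox → Symbol → Set₁
qWtnˡʰˢ a b S T₁ T₂ (inj₁ A) =
  S (inj₁ A) ×
  (∃[ C ] qDiff S T₁ T₂ [ A ⟨ a ⟩ ]⁺ (assertionQuery C a) [])
qWtnˡʰˢ a b S T₁ T₂ (inj₂ r) =
  S (inj₂ r) ×
  (∃[ C ] ∃[ c ] ((c ≡ a ⊎ c ≡ b) ×
    qDiff S T₁ T₂ [ r ⟨ a ⨾ b ⟩ ]⁺ (assertionQuery C c) []))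

------------------------------------------------------------------------
-- Terminologies

-- ⊤, ⊤ ⊓ ⊤, etc.
data OnlyTop : EL → Set where
  ⊤ᶜ  : OnlyTop ⊤ᶜ
  _⊓_ : ∀ {C D} → OnlyTop C → OnlyTop D → OnlyTop (C ⊓ D)

data BasicLHS : LHS → Set where
  atom : ∀ A → BasicLHS (con (atom A))
  dom  : ∀ r → BasicLHS (con (∃ᶜ r ⊤ᶜ))
  ran  : ∀ r → BasicLHS (ran r)

data TerminologyForm : Inclusion → Set where
  incl : ∀ {E C} → BasicLHS E → ¬ OnlyTop C → TerminologyForm (E ⊑ C)
  defn : ∀ {A C} → ¬ OnlyTop C → TerminologyForm (atom A ≣ C)
  role : ∀ {r s} → TerminologyForm (r ⊑ᴿ s)

lhsName : Inclusion → Maybe N_C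
lhsName (con (atom A) ⊑ C) = just A
lhsName (atom A ≣ C)       = just A
lhsName _                  = nothing

record IsTerminology (T : TBox) : Set where
  field
    form       : All TerminologyForm T
    -- Stated through membership: a repeated list entry is a single axiom.
    unique-lhs : ∀ {α β A} → α ∈ T → β ∈ T →
                 lhsName α ≡ just A → lhsName β ≡ just A → α ≡ β

module _ (T : TBox) where

  PseudoPrimitive : N_C → Set
  PseudoPrimitive A = ¬ (∃[ C ] (atom A ≣ C) ∈ T)

  NonConjunctive : N_C → Set
  NonConjunctive A =
    PseudoPrimitive A ⊎ (∃[ r ] ∃[ C ] (atom A ≣ ∃ᶜ r C) ∈ T)

  data NonConjunctives : EL → Set where
    atom : ∀ {A} → NonConjunctive A → NonConjunctives (atom A)
    _⊓_  : ∀ {F G} → NonConjunctives F → NonConjunctives G →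
           NonConjunctives (F ⊓ G)

  data NormalForm : Inclusion → Set where
    defn-∃ : ∀ {A r B} → NormalForm (atom A ≣ ∃ᶜ r (atom B))
    defn-⊓ : ∀ {A F} → NonConjunctives F → NormalForm (atom A ≣ F)
    incl-∃ : ∀ {E r B} → BasicLHS E → NormalForm (E ⊑ ∃ᶜ r (atom B))
    incl-⊤ : ∀ {E r} → BasicLHS E → NormalForm (E ⊑ ∃ᶜ r ⊤ᶜ)
    incl-⊓ : ∀ {E F} → BasicLHS E → NonConjunctives F → NormalForm (E ⊑ F)
    role   : ∀ {r s} → NormalForm (r ⊑ᴿ s)

record IsNormalisedTerminology (T : TBox) : Set where
  field
    isTerminology : IsTerminology T
    normalised    : All (NormalForm T) T

------------------------------------------------------------------------
-- Model of computation: first-order call-by-value recursive programs over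
-- binary trees, in the style of Jones ("Computability and Complexity: From
-- a Programming Perspective"); running time is the number of expression
-- evaluations.  Every primitive only moves, builds or inspects one cell, so
-- on a machine with shared cells each evaluation takes constant time, and
-- polynomial time here is polynomial time on Turing machines.

data Tree : Set where
  nil : Tree
  _∙_ : Tree → Tree → Tree

size : Tree → ℕ
size nil     = 1
size (s ∙ t) = suc (size s + size t)

data Expr {f} (arity : Fin f → ℕ) (n : ℕ) : Set where
  var   : Fin n → Expr arity n
  nil   : Expr arity n
  cons  : Expr arity n → Expr arity n → Expr arity n
  -- Branch on nil or on a cell, whose two components are bound as
  -- variables 0 and 1.
  match : Expr arity n → Expr arity n → Expr arity (2 + n) → Expr arity n
  let′  : Expr arity n → Expr arity (suc n) → Expr arity n
  call  : ∀ g → Vec (Expr arity n) (arity g) → Expr arity n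

record Program : Set where
  field
    {functions} : ℕ
    arity       : Fin functions → ℕ
    body        : ∀ g → Expr arity (arity g)
    main        : Expr arity 1

module Evaluation (p : Program) where
  open Program p

  infix 3 _⊢_⇓_within_ _⊢*_⇓_within_

  mutual
    data _⊢_⇓_within_ {n} (ρ : Vec Tree n) :
                      Expr arity n → Tree → ℕ → Set where
      var : ∀ {x} → ρ ⊢ var x ⇓ lookup ρ x within 1

      nil : ρ ⊢ nil ⇓ nil within 1

      cons : ∀ {e e′ s s′ k k′} →
             ρ ⊢ e ⇓ s within k → ρ ⊢ e′ ⇓ s′ within k′ →
             ρ ⊢ cons e e′ ⇓ s ∙ s′ within suc (k + k′)

      match-nil : ∀ {e e₀ e₁ t k k′} →
                  ρ ⊢ e ⇓ nil within k → ρ ⊢ e₀ ⇓ t within k′ →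
                  ρ ⊢ match e e₀ e₁ ⇓ t within suc (k + k′)

      match-cons : ∀ {e e₀ e₁ s s′ t k k′} →
                   ρ ⊢ e ⇓ s ∙ s′ within k →
                   (s ∷ s′ ∷ ρ) ⊢ e₁ ⇓ t within k′ →
                   ρ ⊢ match e e₀ e₁ ⇓ t within suc (k + k′)

      let′ : ∀ {e e′ s t k k′} →
             ρ ⊢ e ⇓ s within k → (s ∷ ρ) ⊢ e′ ⇓ t within k′ →
             ρ ⊢ let′ e e′ ⇓ t within suc (k + k′)

      call : ∀ {g es ss t k k′} →
             ρ ⊢* es ⇓ ss within k → ss ⊢ body g ⇓ t within k′ →
             ρ ⊢ call g es ⇓ t within suc (k + k′)

    data _⊢*_⇓_within_ {n} (ρ : Vec Tree n) :
                       ∀ {j} → Vec (Expr arity n) j → Vec Tree j → ℕ → Set where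
      []  : ρ ⊢* [] ⇓ [] within 0

      _∷_ : ∀ {j e s k k′} {es : Vec (Expr arity n) j} {ss} →
            ρ ⊢ e ⇓ s within k → ρ ⊢* es ⇓ ss within k′ →
            ρ ⊢* e ∷ es ⇓ s ∷ ss within k + k′

_on_returns_within_ : Program → Tree → Tree → ℕ → Set
p on s returns t within k = (s ∷ []) ⊢ Program.main p ⇓ t within k
  where open Evaluation p

-- A single program that, on every admissible input, halts within polynomially
-- many steps in the size of the input with an output meeting the specification.
-- The size of the output is charged for as well, since a tree with shared
-- subtrees can be much larger than the number of cells built for it.
PolynomialTime : ∀ {ℓ₁ ℓ₂} {X Y : Set} → (X → Tree) → (Y → Tree) →
                 (X → Set ℓ₁) → (X → Y → Set ℓ₂) → Set (ℓ₁ ⊔ ℓ₂)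
PolynomialTime {X = X} {Y} inp out Admissible Spec =
  Σ[ p ∈ Program ] Σ[ c ∈ ℕ ] Σ[ d ∈ ℕ ] ((x : X) → Admissible x →
    Σ[ y ∈ Y ] Σ[ k ∈ ℕ ]
      (p on inp x returns out y within k ×
       k + size (out y) ≤ c * size (inp x) ^ d ×
       Spec x y))

------------------------------------------------------------------------
-- Encoding of inputs and outputs

encList : ∀ {X : Set} → (X → Tree) → List X → Tree
encList enc []       = nil
encList enc (x ∷ xs) = enc x ∙ encList enc xs

numeral : ℕ → Tree
numeral zero    = nil
numeral (suc n) = nil ∙ numeral n

tagged : ℕ → List Tree → Tree
tagged i ts = numeral i ∙ encList id ts

encBool : Bool → Tree
encBool false = nil
encBool true  = nil ∙ nil

encName : ∀ {k} → Name k → Tree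
encName (name w) = encList encBool w

encSymbol : Symbol → Tree
encSymbol (inj₁ A) = tagged 0 (encName A ∷ [])
encSymbol (inj₂ r) = tagged 1 (encName r ∷ [])

encEL : EL → Tree
encEL (atom A) = tagged 0 (encName A ∷ [])
encEL ⊤ᶜ       = tagged 1 []
encEL (C ⊓ D)  = tagged 2 (encEL C ∷ encEL D ∷ [])
encEL (∃ᶜ r C) = tagged 3 (encName r ∷ encEL C ∷ [])

encLHS : LHS → Tree
encLHS (con C)      = tagged 0 (encEL C ∷ [])
encLHS (ran r)      = tagged 1 (encName r ∷ [])
encLHS (ran r ⊓ᴸ C) = tagged 2 (encName r ∷ encEL C ∷ [])

encInclusion : Inclusion → Tree
encInclusion (E ⊑ C)  = tagged 0 (encLHS E ∷ encEL C ∷ [])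
encInclusion (C ≣ D)  = tagged 1 (encEL C ∷ encEL D ∷ [])
encInclusion (r ⊑ᴿ s) = tagged 2 (encName r ∷ encName s ∷ [])

encSymbols : List Symbol → Tree
encSymbols = encList encSymbol

Input : Set
Input = TBox × TBox × List Symbol

encInput : Input → Tree
encInput (T₁ , T₂ , S) =
  encList encInclusion T₁ ∙ (encList encInclusion T₂ ∙ encSymbols S)

{-# OPTIONS --safe #-}

-- Over any ELHʳ-TBox T, the canonical model generated by an individual has as
-- elements pairs of a role r and a concept C, standing for an r-successor in
-- C, both taken from the input.  So it has polynomial size, and the concepts
-- that hold at its elements are found by saturation.  T entails an assertion
-- with a C⊓u-concept iff the canonical model satisfies it.  Hence no such
-- Σ-concept distinguishes T₁ from T₂ at a or b iff the greatest relation that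
-- simulates one canonical model by the other, with respect to concept names
-- and conjunctions of role names in Σ, relates the individuals to themselves
-- and every element of the first model to some element of the second.  The
-- complement of that relation is again found by saturation, and each pair in
-- it is witnessed by a distinguishing concept.
--
-- The time bound is compositional: the algorithm is written in combinators on
-- trees that carry polynomial bounds, and a fixed program interprets them.

module Submission where

open import Defs
open import Data.Bool.Base using (Bool; true; false)
import Data.Bool.Properties as Bool
open import Data.Empty using (⊥)
open import Data.Fin using (#_)
open import Data.Fin.Base using (Fin; zero; suc)
open import Data.Fin.Patterns using (0F; 1F; 2F)
open import Data.List.Base using (List; []; _∷_; _++_; map; length; filter; concatMap)
open import Data.List.NonEmpty.Base using (toList) renaming (_∷_ to _∷⁺_; [_] to [_]⁺)
open import Data.List.Properties using (map-id; map-∘; map-cong; ≡-dec; concatMap-++)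
open import Data.List.Membership.Propositional using (_∈_; _∉_)
open import Data.List.Membership.Propositional.Properties
  using (∈-++⁺ˡ; ∈-++⁺ʳ; ∈-++⁻; ∈-map⁺; ∈-map⁻; ∈-filter⁺; ∈-filter⁻)
import Data.List.Membership.DecPropositional as DecMembership
open import Data.List.Relation.Unary.All as All using (All; []; _∷_)
import Data.List.Relation.Unary.All.Properties as All
open import Data.List.Relation.Unary.Any using (here; there)
open import Data.Nat.Base
  using (ℕ; zero; suc; _+_; _*_; _^_; _≤_; _<_; z≤n; s≤s; NonZero)
open import Data.Nat.Properties
open import Algebra.Properties.CommutativeSemigroup +-commutativeSemigroup
  using (x∙yz≈y∙xz) renaming (interchange to +-interchange)
open import Algebra.Properties.CommutativeSemigroup *-commutativeSemigroup
  using () renaming (interchange to *-interchange)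
open import Data.Product.Base using (Σ-syntax; ∃; _×_; _,_; proj₁; proj₂)
open import Data.Sum.Base using (_⊎_; inj₁; inj₂; [_,_]′)
open import Data.Unit.Base using (⊤; tt)
open import Data.Vec.Base using (Vec; []; _∷_; lookup)
import Data.Vec.Relation.Unary.All as Vec
open import Function.Base using (_∘_; id)
open import Function.Bundles using (_⇔_; mk⇔; Equivalence)
open import Relation.Binary.PropositionalEquality hiding ([_])
open import Relation.Nullary using (¬_; Dec; yes; no; contradiction; ¬?)
open import Relation.Nullary.Decidable using (decidable-stable)
import Relation.Nullary.Decidable as Dec

-- Polynomial bounds

-- An element carries the role by which it is reached because range axioms can give an r-successor
-- and an s-successor in the same C different properties. A one-assertion ABox is replaced by a
-- single generating concept, `A` for A(a) and the existential over r for r(a,b), with b taken to be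
-- the resulting successor; so one construction serves both kinds of symbols. The simulation is
-- handled through its complement because failure of simulation is generated inductively: a
-- derivation of it can be read as a concept, provided that the possible answers to an edge are kept
-- as a finite list. In the other direction, matching successors are obtained only up to double
-- negation, which is harmless because the final test is decidable. Interpreting the combinators
-- makes each of them data for the same three functions, so their running times can be added without
-- merging function tables.

data Poly : Set where
  𝕏       : Poly
  K       : ℕ → Poly
  _⊕_ _⊗_ _⊚_ : Poly → Poly → Poly

infixl 6 _⊕_
infixl 7 _⊗_
infixr 8 _⊚_

⟪_⟫ : Poly → ℕ → ℕ
⟪ 𝕏 ⟫     n = n
⟪ K k ⟫   n = k
⟪ P ⊕ Q ⟫ n = ⟪ P ⟫ n + ⟪ Q ⟫ n
⟪ P ⊗ Q ⟫ n = ⟪ P ⟫ n * ⟪ Q ⟫ n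
⟪ P ⊚ Q ⟫ n = ⟪ P ⟫ (⟪ Q ⟫ n)

⟪⟫-mono : ∀ P {m n} → m ≤ n → ⟪ P ⟫ m ≤ ⟪ P ⟫ n
⟪⟫-mono 𝕏       le = le
⟪⟫-mono (K k)   le = ≤-refl
⟪⟫-mono (P ⊕ Q) le = +-mono-≤ (⟪⟫-mono P le) (⟪⟫-mono Q le)
⟪⟫-mono (P ⊗ Q) le = *-mono-≤ (⟪⟫-mono P le) (⟪⟫-mono Q le)
⟪⟫-mono (P ⊚ Q) le = ⟪⟫-mono P (⟪⟫-mono Q le)

⟪⟫-monomial : ∀ P → Σ[ c ∈ ℕ ] Σ[ d ∈ ℕ ] (∀ n → .{{NonZero n}} → ⟪ P ⟫ n ≤ c * n ^ d)
⟪⟫-monomial 𝕏     = 1 , 1 , λ n →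
  ≤-reflexive (sym (trans (*-identityˡ (n ^ 1)) (*-identityʳ n)))
⟪⟫-monomial (K k) = k , 0 , λ n → ≤-reflexive (sym (*-identityʳ k))
⟪⟫-monomial (P ⊕ Q) with c , d , p ← ⟪⟫-monomial P | c′ , d′ , q ← ⟪⟫-monomial Q =
  c + c′ , d + d′ , λ n → begin
    ⟪ P ⟫ n + ⟪ Q ⟫ n
      ≤⟨ +-mono-≤ (p n) (q n) ⟩
    c * n ^ d + c′ * n ^ d′
      ≤⟨ +-mono-≤ (*-monoʳ-≤ c (^-monoʳ-≤ n (m≤m+n d d′)))
                  (*-monoʳ-≤ c′ (^-monoʳ-≤ n (m≤n+m d′ d))) ⟩
    c * n ^ (d + d′) + c′ * n ^ (d + d′)
      ≡⟨ *-distribʳ-+ (n ^ (d + d′)) c c′ ⟨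
    (c + c′) * n ^ (d + d′) ∎
  where open ≤-Reasoning
⟪⟫-monomial (P ⊗ Q) with c , d , p ← ⟪⟫-monomial P | c′ , d′ , q ← ⟪⟫-monomial Q =
  c * c′ , d + d′ , λ n → begin
    ⟪ P ⟫ n * ⟪ Q ⟫ n               ≤⟨ *-mono-≤ (p n) (q n) ⟩
    (c * n ^ d) * (c′ * n ^ d′)     ≡⟨ *-interchange c (n ^ d) c′ (n ^ d′) ⟩
    (c * c′) * (n ^ d * n ^ d′)     ≡⟨ cong ((c * c′) *_) (^-distribˡ-+-* n d d′) ⟨
    (c * c′) * n ^ (d + d′)         ∎
  where open ≤-Reasoning
⟪⟫-monomial (P ⊚ Q) with c , d , p ← ⟪⟫-monomial P | c′ , d′ , q ← ⟪⟫-monomial Q =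
  -- The coefficient c′ may be 0; passing to `suc c′` keeps the argument of P nonzero, as the bound
  -- for P requires.
  c * suc c′ ^ d , d′ * d , λ n → begin
    ⟪ P ⟫ (⟪ Q ⟫ n)
      ≤⟨ ⟪⟫-mono P (≤-trans (q n) (*-monoˡ-≤ (n ^ d′) (n≤1+n c′))) ⟩
    ⟪ P ⟫ (suc c′ * n ^ d′)
      ≤⟨ p (suc c′ * n ^ d′) {{m*n≢0 (suc c′) (n ^ d′) {{_}} {{m^n≢0 n d′}}}} ⟩
    c * (suc c′ * n ^ d′) ^ d
      ≡⟨ cong (c *_) (trans (power-* (suc c′) (n ^ d′) d)
                            (cong (suc c′ ^ d *_) (^-*-assoc n d′ d))) ⟩
    c * (suc c′ ^ d * n ^ (d′ * d))
      ≡⟨ *-assoc c _ _ ⟨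
    c * suc c′ ^ d * n ^ (d′ * d) ∎
  where
  open ≤-Reasoning
  power-* : ∀ m n d → (m * n) ^ d ≡ m ^ d * n ^ d
  power-* m n zero    = refl
  power-* m n (suc d) = trans (cong (m * n *_) (power-* m n d))
                              (*-interchange m n (m ^ d) (n ^ d))

-- An interpreter of combinators

ttᵗ : Tree
ttᵗ = nil ∙ nil

hd tl : Tree → Tree
hd nil     = nil
hd (s ∙ t) = s
tl nil     = nil
tl (s ∙ t) = t

ifᵗ_then_else_ : Tree → Tree → Tree → Tree
ifᵗ nil   then t else f = f
ifᵗ _ ∙ _ then t else f = t

eqᵗ : Tree → Tree → Tree
eqᵗ nil       nil       = ttᵗ
eqᵗ nil       (_ ∙ _)   = nil
eqᵗ (_ ∙ _)   nil       = nil
eqᵗ (s₁ ∙ s₂) (t₁ ∙ t₂) = ifᵗ eqᵗ s₁ t₁ then eqᵗ s₂ t₂ else nil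

eqPair : Tree → Tree
eqPair nil     = nil
eqPair (s ∙ t) = eqᵗ s t

foldᵗ : (z s : Tree → Tree) → Tree → Tree → Tree
foldᵗ z s e nil         = z e
foldᵗ z s e t@(t₁ ∙ t₂) = s ((foldᵗ z s e t₁ ∙ foldᵗ z s e t₂) ∙ (t ∙ e))

foldPair : (z s : Tree → Tree) → Tree → Tree
foldPair z s nil     = nil
foldPair z s (t ∙ e) = foldᵗ z s e t

-- The program is an interpreter of combinators coded as trees: function 0 runs
-- a combinator on an argument, and functions 1 and 2 compute foldᵗ and eqᵗ.
arity : Fin 3 → ℕ
arity 0F = 2
arity 1F = 4
arity 2F = 2

private
  E : ℕ → Set
  E = Expr arity

  evalₑ : ∀ {n} → E n → E n → E n
  evalₑ c x = call 0F (c ∷ x ∷ [])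

  foldₑ : ∀ {n} → E n → E n → E n → E n → E n
  foldₑ z s t e = call 1F (z ∷ s ∷ t ∷ e ∷ [])

  eqₑ : ∀ {n} → E n → E n → E n
  eqₑ s t = call 2F (s ∷ t ∷ [])

  quoteᵗ : ∀ {n} → Tree → E n
  quoteᵗ nil     = nil
  quoteᵗ (s ∙ t) = cons (quoteᵗ s) (quoteᵗ t)

body : ∀ g → Expr arity (arity g)
-- The clauses dispatch on the numerals 0, …, 7 tagging the combinators.  Each
-- match on a numeral shifts the indices of the arguments and of x by two.
body 0F =
  match (var (# 0)) (var (# 1))
  (match (var (# 0))
     (match (var (# 1)) nil
        (evalₑ (var (# 0)) (evalₑ (var (# 1)) (var (# 5)))))
  (match (var (# 1))
     (match (var (# 3)) nil
        (cons (evalₑ (var (# 0)) (var (# 7))) (evalₑ (var (# 1)) (var (# 7)))))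
  (match (var (# 1)) (match (var (# 7)) nil (var (# 0)))
  (match (var (# 1)) (match (var (# 9)) nil (var (# 1)))
  (match (var (# 1)) nil
  (match (var (# 1))
     (match (var (# 11)) nil (match (var (# 1)) nil
        (match (evalₑ (var (# 2)) (var (# 17)))
           (evalₑ (var (# 1)) (var (# 17)))
           (evalₑ (var (# 2)) (var (# 19))))))
  (match (var (# 1)) (match (var (# 15)) nil (eqₑ (var (# 0)) (var (# 1))))
  (match (var (# 15)) nil (match (var (# 19)) nil
     (foldₑ (var (# 2)) (var (# 3)) (var (# 0)) (var (# 1))))))))))))
body 1F =
  match (var (# 2)) (evalₑ (var (# 0)) (var (# 3)))
    (evalₑ (var (# 3))
      (cons (cons (foldₑ (var (# 2)) (var (# 3)) (var (# 0)) (var (# 5)))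
                  (foldₑ (var (# 2)) (var (# 3)) (var (# 1)) (var (# 5))))
            (cons (var (# 4)) (var (# 5)))))
body 2F =
  match (var (# 0))
    (match (var (# 1)) (cons nil nil) nil)
    (match (var (# 3)) nil
      (match (eqₑ (var (# 2)) (var (# 0))) nil (eqₑ (var (# 5)) (var (# 3)))))

interpreter : Tree → Program
interpreter c = record { arity = arity ; body = body ; main = evalₑ (quoteᵗ c) (var 0F) }

idᶜ headᶜ tailᶜ nilᶜ eqᶜ : Tree
idᶜ   = nil
headᶜ = numeral 2 ∙ nil
tailᶜ = numeral 3 ∙ nil
nilᶜ  = numeral 4 ∙ nil
eqᶜ   = numeral 6 ∙ nil

compᶜ pairᶜ foldᶜ : Tree → Tree → Tree
compᶜ f g = numeral 0 ∙ (f ∙ g)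
pairᶜ f g = numeral 1 ∙ (f ∙ g)
foldᶜ z s = numeral 7 ∙ (z ∙ s)

ifᶜ : Tree → Tree → Tree → Tree
ifᶜ c f g = numeral 5 ∙ (c ∙ (f ∙ g))

module Machine (m : Tree) where

  open Evaluation (interpreter m) public

  Runs : Tree → Tree → Tree → ℕ → Set
  Runs c x y k = (c ∷ x ∷ []) ⊢ body 0F ⇓ y within k

  run-id : ∀ x → Runs idᶜ x x 3
  run-id x = match-nil var var

  -- Costs are written in the shape in which the derivations produce them, hence the summand 0 from
  -- the end of the argument list.
  run-comp : ∀ {f g x y z k l} → Runs g x y k → Runs f y z l →
             Runs (compᶜ f g) x z (11 + (k + 0 + l))
  run-comp p q =
    match-cons var (match-nil var (match-cons var
      (call (var ∷ call (var ∷ var ∷ []) p ∷ []) q)))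

  run-pair : ∀ {f g x y z k l} → Runs f x y k → Runs g x z l →
             Runs (pairᶜ f g) x (y ∙ z) (12 + (k + (3 + l)))
  run-pair p q =
    match-cons var (match-cons var (match-nil var (match-cons var
      (cons (call (var ∷ var ∷ []) p) (call (var ∷ var ∷ []) q)))))

  run-head : ∀ x → Runs headᶜ x (hd x) 11
  run-head nil     = match-cons var (match-cons var (match-cons var (match-nil var
    (match-nil var nil))))
  run-head (_ ∙ _) = match-cons var (match-cons var (match-cons var (match-nil var
    (match-cons var var))))

  run-tail : ∀ x → Runs tailᶜ x (tl x) 13
  run-tail nil     = match-cons var (match-cons var (match-cons var (match-cons var
    (match-nil var (match-nil var nil)))))
  run-tail (_ ∙ _) = match-cons var (match-cons var (match-cons var (match-cons var
    (match-nil var (match-cons var var)))))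

  run-nil : ∀ x → Runs nilᶜ x nil 13
  run-nil x = match-cons var (match-cons var (match-cons var (match-cons var
    (match-cons var (match-nil var nil)))))

  run-else : ∀ {c f g x y k l} → Runs c x nil k → Runs g x y l →
             Runs (ifᶜ c f g) x y (22 + (k + (3 + l)))
  run-else p q = match-cons var (match-cons var (match-cons var (match-cons var
    (match-cons var (match-cons var (match-nil var (match-cons var (match-cons var
      (match-nil (call (var ∷ var ∷ []) p) (call (var ∷ var ∷ []) q))))))))))

  run-then : ∀ {c f g x u w y k l} → Runs c x (u ∙ w) k → Runs f x y l →
             Runs (ifᶜ c f g) x y (22 + (k + (3 + l)))
  run-then p q = match-cons var (match-cons var (match-cons var (match-cons var
    (match-cons var (match-cons var (match-nil var (match-cons var (match-cons var
      (match-cons (call (var ∷ var ∷ []) p) (call (var ∷ var ∷ []) q))))))))))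

  eq-cost : ∀ a b → 8 + (11 * a + (3 + 11 * b)) ≡ 11 * (1 + (a + b))
  eq-cost a b = begin
    8 + (11 * a + (3 + 11 * b))  ≡⟨ cong (8 +_) (x∙yz≈y∙xz (11 * a) 3 (11 * b)) ⟩
    11 + (11 * a + 11 * b)       ≡⟨ cong (11 +_) (*-distribˡ-+ 11 a b) ⟨
    11 + 11 * (a + b)            ≡⟨ *-suc 11 (a + b) ⟨
    11 * (1 + (a + b))           ∎
    where open ≡-Reasoning

  -- The comparison descends in both trees at once, so the nodes of the first suffice to count
  -- calls. Comparing two cells costs 8 + 3 beyond the recursive calls, whence 11 per node.
  run-eqᵗ : ∀ s t → Σ[ k ∈ ℕ ] ((s ∷ t ∷ []) ⊢ body 2F ⇓ eqᵗ s t within k × k ≤ 11 * size s)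
  run-eqᵗ nil     nil     = _ , match-nil var (match-nil var (cons nil nil)) , m≤m+n 7 4
  run-eqᵗ nil     (_ ∙ _) = _ , match-nil var (match-cons var nil) , m≤m+n 5 6
  run-eqᵗ (s₁ ∙ s₂) nil   = _ , match-cons var (match-nil var nil) ,
    ≤-trans (m≤m+n 5 6) (*-monoʳ-≤ 11 (s≤s z≤n))
  run-eqᵗ (s₁ ∙ s₂) (t₁ ∙ t₂)
    with eqᵗ s₁ t₁ | run-eqᵗ s₁ t₁ | eqᵗ s₂ t₂ | run-eqᵗ s₂ t₂
  ... | nil   | k , p , k≤ | _ | _          =
    _ , match-cons var (match-cons var (match-nil (call (var ∷ var ∷ []) p) nil)) ,
    (begin
      8 + (k + 1)                  ≤⟨ +-monoʳ-≤ 8 (+-mono-≤ k≤ (m≤m+n 1 (2 + 11 * size s₂))) ⟩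
      8 + (11 * size s₁ + (3 + 11 * size s₂)) ≡⟨ eq-cost (size s₁) (size s₂) ⟩
      11 * size (s₁ ∙ s₂) ∎)
    where open ≤-Reasoning
  ... | _ ∙ _ | k , p , k≤ | _ | l , q , l≤ =
    _ , match-cons var (match-cons var (match-cons (call (var ∷ var ∷ []) p)
                                                   (call (var ∷ var ∷ []) q))) ,
    (begin
      8 + (k + (3 + l))            ≤⟨ +-monoʳ-≤ 8 (+-mono-≤ k≤ (+-monoʳ-≤ 3 l≤)) ⟩
      8 + (11 * size s₁ + (3 + 11 * size s₂)) ≡⟨ eq-cost (size s₁) (size s₂) ⟩
      11 * size (s₁ ∙ s₂) ∎)
    where open ≤-Reasoning

  run-eq : ∀ x → Σ[ k ∈ ℕ ] (Runs eqᶜ x (eqPair x) k × k ≤ 21 + 11 * size x)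
  run-eq nil = _ , match-cons var (match-cons var (match-cons var (match-cons var
    (match-cons var (match-cons var (match-cons var (match-nil var (match-nil var nil)))))))) ,
    m≤m+n 19 13
  run-eq (s ∙ t) with k , p , k≤ ← run-eqᵗ s t =
    _ , match-cons var (match-cons var (match-cons var (match-cons var
    (match-cons var (match-cons var (match-cons var (match-nil var (match-cons var
      (call (var ∷ var ∷ []) p))))))))) ,
    +-monoʳ-≤ 21 (≤-trans k≤ (*-monoʳ-≤ 11 (≤-trans (m≤m+n (size s) (size t)) (n≤1+n _))))

  Folds : (z s e t y : Tree) → ℕ → Set
  Folds z s e t y k = (z ∷ s ∷ t ∷ e ∷ []) ⊢ body 1F ⇓ y within k

  run-fold-nil : ∀ {z s e y k} → Runs z e y k → Folds z s e nil y (5 + k)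
  run-fold-nil p = match-nil var (call (var ∷ var ∷ []) p)

  run-fold-∙ : ∀ {z s e t₁ t₂ y₁ y₂ y k₁ k₂ k} →
    Folds z s e t₁ y₁ k₁ → Folds z s e t₂ y₂ k₂ →
    Runs s ((y₁ ∙ y₂) ∙ ((t₁ ∙ t₂) ∙ e)) y k →
    Folds z s e (t₁ ∙ t₂) y (11 + (k₁ + (5 + k₂) + 3 + 0 + k))
  run-fold-∙ p₁ p₂ q = match-cons var (call (var ∷ cons (cons
    (call (var ∷ var ∷ var ∷ var ∷ []) p₁) (call (var ∷ var ∷ var ∷ var ∷ []) p₂))
    (cons var var) ∷ []) q)

  run-fold : ∀ {z s e t y k} → Folds z s e t y k → Runs (foldᶜ z s) (t ∙ e) y (25 + k)
  run-fold p = match-cons var (match-cons var (match-cons var (match-cons var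
    (match-cons var (match-cons var (match-cons var (match-cons var (match-cons var (match-cons var
      (call (var ∷ var ∷ var ∷ var ∷ []) p))))))))))

  run-fold-empty : ∀ z s → Runs (foldᶜ z s) nil nil 21
  run-fold-empty z s = match-cons var (match-cons var (match-cons var (match-cons var
    (match-cons var (match-cons var (match-cons var (match-cons var (match-cons var (match-nil var
      nil)))))))))

  run-quoteᵗ : ∀ t {n} {ρ : Vec Tree n} →
               Σ[ k ∈ ℕ ] ((ρ ⊢ quoteᵗ t ⇓ t within k) × k ≤ size t)
  run-quoteᵗ nil     = 1 , nil , ≤-refl
  run-quoteᵗ (s ∙ t) with i , p , i≤ ← run-quoteᵗ s | j , q , j≤ ← run-quoteᵗ t =
    _ , cons p q , s≤s (+-mono-≤ i≤ j≤)

  run-main : ∀ {x y k} → Runs m x y k →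
    Σ[ k′ ∈ ℕ ] (((x ∷ []) ⊢ Program.main (interpreter m) ⇓ y within k′) × k′ ≤ 2 + size m + k)
  run-main {k = k} p with l , q , l≤ ← run-quoteᵗ m = _ , call (q ∷ var ∷ []) p ,
    s≤s (+-monoˡ-≤ k (≤-trans (+-monoˡ-≤ 1 l≤) (≤-reflexive (+-comm (size m) 1))))

-- The code `m` is arbitrary because a combinator also runs as part of larger ones, under a `main`
-- that quotes a different code. One bound covers time and output size, since the output is what the
-- next combinator has to process.
record Fn : Set where
  no-eta-equality
  field
    sem   : Tree → Tree
    code  : Tree
    bound : Poly
    runs  : ∀ m x → Σ[ k ∈ ℕ ] (Machine.Runs m code x (sem x) k ×
                                k + size (sem x) ≤ ⟪ bound ⟫ (size x))

  size-bound : ∀ x → size (sem x) ≤ ⟪ bound ⟫ (size x)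
  size-bound x with k , _ , le ← runs nil x = ≤-trans (m≤n+m _ k) le

open Fn public

hd-size : ∀ x → size (hd x) ≤ size x
hd-size nil     = ≤-refl
hd-size (s ∙ t) = ≤-trans (m≤m+n _ (size t)) (n≤1+n _)

tl-size : ∀ x → size (tl x) ≤ size x
tl-size nil     = ≤-refl
tl-size (s ∙ t) = ≤-trans (m≤n+m _ (size s)) (n≤1+n _)

module _ where
  open Machine

  id′ head′ tail′ nil′ : Fn

  id′ = record
    { sem = λ x → x ; code = idᶜ ; bound = K 3 ⊕ 𝕏
    ; runs = λ m x → _ , run-id m x , ≤-refl }

  head′ = record
    { sem = hd ; code = headᶜ ; bound = K 11 ⊕ 𝕏
    ; runs = λ m x → _ , run-head m x , +-monoʳ-≤ 11 (hd-size x) }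

  tail′ = record
    { sem = tl ; code = tailᶜ ; bound = K 13 ⊕ 𝕏
    ; runs = λ m x → _ , run-tail m x , +-monoʳ-≤ 13 (tl-size x) }

  nil′ = record
    { sem = λ _ → nil ; code = nilᶜ ; bound = K 14
    ; runs = λ m x → _ , run-nil m x , ≤-refl }

  infixr 9 _∘′_
  _∘′_ : Fn → Fn → Fn
  f ∘′ g = record
    { sem   = λ x → sem f (sem g x)
    ; code  = compᶜ (code f) (code g)
    ; bound = K 11 ⊕ (bound g ⊕ bound f ⊚ bound g)
    ; runs  = λ m x →
        let k , p , k≤ = runs g m x
            l , q , l≤ = runs f m (sem g x)
        in _ , run-comp m p q , (begin
          11 + (k + 0 + l) + size (sem f (sem g x))
            ≡⟨ +-assoc 11 (k + 0 + l) _ ⟩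
          11 + (k + 0 + l + size (sem f (sem g x)))
            ≡⟨ cong (11 +_) (+-assoc (k + 0) l _) ⟩
          11 + (k + 0 + (l + size (sem f (sem g x))))
            ≤⟨ +-monoʳ-≤ 11 (+-mono-≤
                 (≤-trans (+-monoʳ-≤ k z≤n) k≤)
                 (≤-trans l≤ (⟪⟫-mono (bound f) (size-bound g x)))) ⟩
          11 + (⟪ bound g ⟫ (size x) + ⟪ bound f ⟫ (⟪ bound g ⟫ (size x))) ∎)
    }
    where open ≤-Reasoning

  infixr 5 _∙′_
  _∙′_ : Fn → Fn → Fn
  f ∙′ g = record
    { sem   = λ x → sem f x ∙ sem g x
    ; code  = pairᶜ (code f) (code g)
    ; bound = K 16 ⊕ (bound f ⊕ bound g)
    ; runs  = λ m x →
        let k , p , k≤ = runs f m x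
            l , q , l≤ = runs g m x
            a = size (sem f x) ; b = size (sem g x)
        in _ , run-pair m p q , (begin
          12 + (k + (3 + l)) + suc (a + b)  ≡⟨ arith k l a b ⟩
          16 + ((k + a) + (l + b))          ≤⟨ +-monoʳ-≤ 16 (+-mono-≤ k≤ l≤) ⟩
          16 + (⟪ bound f ⟫ (size x) + ⟪ bound g ⟫ (size x)) ∎)
    }
    where
    open ≤-Reasoning
    arith : ∀ k l a b → 12 + (k + (3 + l)) + suc (a + b) ≡ 16 + ((k + a) + (l + b))
    arith k l a b = begin-equality
      12 + (k + (3 + l)) + suc (a + b)  ≡⟨ +-suc (12 + (k + (3 + l))) (a + b) ⟩
      13 + (k + (3 + l) + (a + b))      ≡⟨ cong (λ i → 13 + (i + (a + b))) (x∙yz≈y∙xz k 3 l) ⟩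
      16 + (k + l + (a + b))            ≡⟨ cong (16 +_) (+-interchange k l a b) ⟩
      16 + ((k + a) + (l + b))          ∎

  if′ : Fn → Fn → Fn → Fn
  if′ c f g = record
    { sem   = λ x → ifᵗ sem c x then sem f x else sem g x
    ; code  = ifᶜ (code c) (code f) (code g)
    ; bound = K 25 ⊕ (bound c ⊕ (bound f ⊕ bound g))
    ; runs  = runs-if
    }
    where
    arith : ∀ k l a {b c d} → k ≤ b → l + a ≤ c → c ≤ d →
            22 + (k + (3 + l)) + a ≤ 25 + (b + d)
    arith k l a {b} {c} {d} p q r = begin
      22 + (k + (3 + l)) + a  ≡⟨ cong (λ i → 22 + i + a) (x∙yz≈y∙xz k 3 l) ⟩
      25 + (k + l + a)        ≡⟨ cong (25 +_) (+-assoc k l a) ⟩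
      25 + (k + (l + a))      ≤⟨ +-monoʳ-≤ 25 (+-mono-≤ p (≤-trans q r)) ⟩
      25 + (b + d)            ∎
      where open ≤-Reasoning
    runs-if : ∀ m x → Σ[ k ∈ ℕ ]
      (Runs m (ifᶜ (code c) (code f) (code g)) x (ifᵗ sem c x then sem f x else sem g x) k ×
       k + size (ifᵗ sem c x then sem f x else sem g x)
         ≤ 25 + (⟪ bound c ⟫ (size x) + (⟪ bound f ⟫ (size x) + ⟪ bound g ⟫ (size x))))
    runs-if m x with sem c x | runs c m x
    ... | nil   | k , p , k≤ = let l , q , l≤ = runs g m x in
      _ , run-else m p q , arith k l _ (≤-trans (m≤m+n k _) k≤) l≤ (m≤n+m _ _)
    ... | _ ∙ _ | k , p , k≤ = let l , q , l≤ = runs f m x in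
      _ , run-then m p q , arith k l _ (≤-trans (m≤m+n k _) k≤) l≤ (m≤m+n _ _)

  eq″ : Fn
  eq″ = record
    { sem = eqPair ; code = eqᶜ ; bound = K 24 ⊕ K 11 ⊗ 𝕏
    ; runs = λ m x → let k , p , k≤ = run-eq m x in k , p ,
        ≤-trans (+-mono-≤ k≤ (eqPair-size x)) (≤-reflexive (+-comm (21 + 11 * size x) 3))
    }
    where
    eqᵗ-size : ∀ s t → size (eqᵗ s t) ≤ 3
    eqᵗ-size nil       nil       = ≤-refl
    eqᵗ-size nil       (_ ∙ _)   = s≤s z≤n
    eqᵗ-size (_ ∙ _)   nil       = s≤s z≤n
    eqᵗ-size (s₁ ∙ s₂) (t₁ ∙ t₂) with eqᵗ s₁ t₁
    ... | nil   = s≤s z≤n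
    ... | _ ∙ _ = eqᵗ-size s₂ t₂
    eqPair-size : ∀ x → size (eqPair x) ≤ 3
    eqPair-size nil     = s≤s z≤n
    eqPair-size (s ∙ t) = eqᵗ-size s t

  -- Recursion is polynomial because a step adds to the sizes of the two
  -- recursive results only an amount bounded in the sizes of the other inputs.
  fold′ : (z s : Fn) (Q : Poly) →
          (∀ a b t e → size (sem s ((a ∙ b) ∙ (t ∙ e))) ≤
                       size a + size b + ⟪ Q ⟫ (size (t ∙ e))) → Fn
  fold′ z s Q small = record
    { sem   = foldPair (sem z) (sem s)
    ; code  = foldᶜ (code z) (code s)
    ; bound = K 25 ⊕ 𝕏 ⊗ work ⊕ 𝕏 ⊗ growth
    ; runs  = runs-fold
    }
    where
    open ≤-Reasoning
    growth work : Poly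
    growth = bound z ⊕ Q
    -- A step runs on two results of total size at most `𝕏 ⊗ growth`, on `t ∙ e` of size at most
    -- `𝕏`, and on two new cells.
    work   = K 22 ⊕ bound z ⊕ bound s ⊚ (K 2 ⊕ 𝕏 ⊗ growth ⊕ 𝕏)

    F : Tree → Tree → Tree
    F = foldᵗ (sem z) (sem s)

    -- The size n of the original input stays fixed while t descends; each node of t then
    -- contributes the same amount, and growth does not compound.
    F-size : ∀ n e t → size (t ∙ e) ≤ n → size (F e t) ≤ size t * ⟪ growth ⟫ n
    left : ∀ {n} t₁ t₂ {e} → size ((t₁ ∙ t₂) ∙ e) ≤ n → size (t₁ ∙ e) ≤ n
    left t₁ t₂ {e} = ≤-trans (s≤s (+-monoˡ-≤ (size e) (hd-size (t₁ ∙ t₂))))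
    right : ∀ {n} t₁ t₂ {e} → size ((t₁ ∙ t₂) ∙ e) ≤ n → size (t₂ ∙ e) ≤ n
    right t₁ t₂ {e} = ≤-trans (s≤s (+-monoˡ-≤ (size e) (tl-size (t₁ ∙ t₂))))
    parts-size : ∀ n e t₁ t₂ → size ((t₁ ∙ t₂) ∙ e) ≤ n →
                 size (F e t₁) + size (F e t₂) ≤ (size t₁ + size t₂) * ⟪ growth ⟫ n
    parts-size n e t₁ t₂ le = begin
      size (F e t₁) + size (F e t₂)
        ≤⟨ +-mono-≤ (F-size n e t₁ (left t₁ t₂ le)) (F-size n e t₂ (right t₁ t₂ le)) ⟩
      size t₁ * ⟪ growth ⟫ n + size t₂ * ⟪ growth ⟫ n
        ≡⟨ *-distribʳ-+ (⟪ growth ⟫ n) (size t₁) (size t₂) ⟨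
      (size t₁ + size t₂) * ⟪ growth ⟫ n ∎
    F-size n e nil le = begin
      size (sem z e)        ≤⟨ size-bound z e ⟩
      ⟪ bound z ⟫ (size e)  ≤⟨ ⟪⟫-mono (bound z) (≤-trans (tl-size (nil ∙ e)) le) ⟩
      ⟪ bound z ⟫ n         ≤⟨ m≤m+n _ _ ⟩
      ⟪ growth ⟫ n          ≡⟨ *-identityˡ _ ⟨
      1 * ⟪ growth ⟫ n      ∎
    F-size n e t@(t₁ ∙ t₂) le = begin
      size (F e t)
        ≤⟨ small (F e t₁) (F e t₂) t e ⟩
      size (F e t₁) + size (F e t₂) + ⟪ Q ⟫ (size (t ∙ e))
        ≤⟨ +-mono-≤ (parts-size n e t₁ t₂ le) (≤-trans (⟪⟫-mono Q le) (m≤n+m _ _)) ⟩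
      (size t₁ + size t₂) * ⟪ growth ⟫ n + ⟪ growth ⟫ n
        ≡⟨ +-comm _ (⟪ growth ⟫ n) ⟩
      size t * ⟪ growth ⟫ n ∎

    arg-size : ∀ n e t₁ t₂ → size ((t₁ ∙ t₂) ∙ e) ≤ n →
               size ((F e t₁ ∙ F e t₂) ∙ ((t₁ ∙ t₂) ∙ e)) ≤ 2 + n * ⟪ growth ⟫ n + n
    arg-size n e t₁ t₂ le = s≤s (s≤s (+-mono-≤
      (≤-trans (parts-size n e t₁ t₂ le)
               (*-monoˡ-≤ (⟪ growth ⟫ n) (≤-trans (m≤m+n _ (size e))
                 (≤-trans (n≤1+n _) (≤-trans (n≤1+n _) le))))) le))

    F-runs : ∀ m n e t → size (t ∙ e) ≤ n → Σ[ k ∈ ℕ ]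
      (Folds m (code z) (code s) e t (F e t) k × k ≤ size t * ⟪ work ⟫ n)
    F-runs m n e nil le with k , p , k≤ ← runs z m e = _ , run-fold-nil m p , (begin
      5 + k            ≤⟨ +-mono-≤ (m≤m+n 5 17) (≤-trans (m≤m+n k _) (≤-trans k≤
                            (⟪⟫-mono (bound z) (≤-trans (tl-size (nil ∙ e)) le)))) ⟩
      22 + ⟪ bound z ⟫ n ≤⟨ m≤m+n _ _ ⟩
      ⟪ work ⟫ n       ≡⟨ *-identityˡ _ ⟨
      1 * ⟪ work ⟫ n   ∎)
    F-runs m n e t@(t₁ ∙ t₂) le
      with k₁ , p₁ , k₁≤ ← F-runs m n e t₁ (left t₁ t₂ le)
         | k₂ , p₂ , k₂≤ ← F-runs m n e t₂ (right t₁ t₂ le)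
         | k  , p  , k≤  ← runs s m ((F e t₁ ∙ F e t₂) ∙ (t ∙ e)) =
      _ , run-fold-∙ m p₁ p₂ p , (begin
        11 + (k₁ + (5 + k₂) + 3 + 0 + k)  ≡⟨ cong (λ i → 11 + (i + k)) (arith k₁ k₂) ⟩
        19 + (k₁ + k₂ + k)                ≡⟨ cong (19 +_) (+-comm (k₁ + k₂) k) ⟩
        19 + k + (k₁ + k₂)
          ≤⟨ +-mono-≤ (+-mono-≤ (≤-trans (m≤m+n 19 3) (m≤m+n 22 (⟪ bound z ⟫ n)))
               (≤-trans (m≤m+n k _) (≤-trans k≤ (⟪⟫-mono (bound s) (arg-size n e t₁ t₂ le)))))
               (+-mono-≤ k₁≤ k₂≤) ⟩
        ⟪ work ⟫ n + (size t₁ * ⟪ work ⟫ n + size t₂ * ⟪ work ⟫ n)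
          ≡⟨ cong (⟪ work ⟫ n +_) (*-distribʳ-+ (⟪ work ⟫ n) (size t₁) (size t₂)) ⟨
        size t * ⟪ work ⟫ n ∎)
      where
      arith : ∀ k₁ k₂ → k₁ + (5 + k₂) + 3 + 0 ≡ 8 + (k₁ + k₂)
      arith k₁ k₂ = begin-equality
        k₁ + (5 + k₂) + 3 + 0  ≡⟨ +-identityʳ _ ⟩
        k₁ + (5 + k₂) + 3      ≡⟨ +-comm _ 3 ⟩
        3 + (k₁ + (5 + k₂))    ≡⟨ cong (3 +_) (x∙yz≈y∙xz k₁ 5 k₂) ⟩
        8 + (k₁ + k₂)          ∎

    runs-fold : ∀ m x → Σ[ k ∈ ℕ ]
      (Runs m (foldᶜ (code z) (code s)) x (foldPair (sem z) (sem s) x) k ×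
       k + size (foldPair (sem z) (sem s) x)
         ≤ 25 + size x * ⟪ work ⟫ (size x) + size x * ⟪ growth ⟫ (size x))
    runs-fold m nil = _ , run-fold-empty m (code z) (code s) ,
      ≤-trans (m≤m+n 22 3) (≤-trans (m≤m+n 25 (1 * ⟪ work ⟫ 1))
        (m≤m+n (25 + 1 * ⟪ work ⟫ 1) (1 * ⟪ growth ⟫ 1)))
    runs-fold m x@(t ∙ e) with k , p , k≤ ← F-runs m (size x) e t ≤-refl =
      _ , run-fold m p , +-mono-≤
        (+-monoʳ-≤ 25 (≤-trans k≤ (*-monoˡ-≤ (⟪ work ⟫ (size x)) (hd-size x))))
        (≤-trans (F-size (size x) e t ≤-refl) (*-monoˡ-≤ (⟪ growth ⟫ (size x)) (hd-size x)))

-- Decidable formulas over trees and their least fixpoints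

v : ℕ → Fn
v zero    = head′
v (suc i) = v i ∘′ tail′

const′ : Tree → Fn
const′ nil     = nil′
const′ (s ∙ t) = const′ s ∙′ const′ t

private
  recʳ cell first env : Fn
  -- Projections of the argument of a fold step, ((left ∙ right) ∙ (t ∙ e)). On a list, `recʳ` is
  -- the result for the tail and `first` the current entry.
  recʳ  = tail′ ∘′ head′
  cell  = head′ ∘′ tail′
  first = head′ ∘′ cell
  env   = tail′ ∘′ tail′

elems : Tree → List Tree
elems nil     = []
elems (x ∙ t) = x ∷ elems t

len : Tree → ℕ
len t = length (elems t)

infix 4 _∈ᵗ_ _∉ᵗ_
_∈ᵗ_ _∉ᵗ_ : Tree → Tree → Set
x ∈ᵗ t = x ∈ elems t
x ∉ᵗ t = x ∉ elems t

data Reflectsᵗ (P : Set) : Tree → Set where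
  yesᵗ : ∀ {s t} → P → Reflectsᵗ P (s ∙ t)
  noᵗ  : ¬ P → Reflectsᵗ P nil

reflect-map : ∀ {P Q t} → (P → Q) → (Q → P) → Reflectsᵗ P t → Reflectsᵗ Q t
reflect-map f g (yesᵗ p) = yesᵗ (f p)
reflect-map f g (noᵗ ¬p) = noᵗ (¬p ∘ g)

reflect-dec : ∀ {P t} → Reflectsᵗ P t → Dec P
reflect-dec (yesᵗ p) = yes p
reflect-dec (noᵗ ¬p) = no ¬p

eqᵗ-reflects : ∀ s t → Reflectsᵗ (s ≡ t) (eqᵗ s t)
eqᵗ-reflects nil       nil       = yesᵗ refl
eqᵗ-reflects nil       (_ ∙ _)   = noᵗ λ ()
eqᵗ-reflects (_ ∙ _)   nil       = noᵗ λ ()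
eqᵗ-reflects (s₁ ∙ s₂) (t₁ ∙ t₂) with eqᵗ s₁ t₁ | eqᵗ-reflects s₁ t₁
... | _ | noᵗ ¬p    = noᵗ λ { refl → ¬p refl }
... | _ | yesᵗ refl = reflect-map (cong (s₁ ∙_)) (cong tl) (eqᵗ-reflects s₂ t₂)

_≟ᵗ_ : (s t : Tree) → Dec (s ≡ t)
s ≟ᵗ t = reflect-dec (eqᵗ-reflects s t)

open DecMembership _≟ᵗ_ using (_∈?_)

-- A formula is evaluated on its environment, the list of the values of its
-- variables, and ∃′ pushes the bound value.
record Formula : Set₁ where
  no-eta-equality
  field
    test    : Fn
    Meaning : Tree → Set
    correct : ∀ ρ → Reflectsᵗ (Meaning ρ) (sem test ρ)

  Meaning? : ∀ ρ → Dec (Meaning ρ)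
  Meaning? ρ = reflect-dec (correct ρ)

open Formula public

infix  4 _≡′_ _∈′_ _∉′_
infixr 3 _∧′_
infixr 2 _∨′_

_≡′_ : Fn → Fn → Formula
f ≡′ g = record
  { test    = eq″ ∘′ (f ∙′ g)
  ; Meaning = λ ρ → sem f ρ ≡ sem g ρ
  ; correct = λ ρ → eqᵗ-reflects (sem f ρ) (sem g ρ) }

¬′_ : Formula → Formula
¬′ φ = record
  { test    = if′ (test φ) nil′ (nil′ ∙′ nil′)
  ; Meaning = λ ρ → ¬ Meaning φ ρ
  ; correct = λ ρ → negate (correct φ ρ) }
  where
  negate : ∀ {P t} → Reflectsᵗ P t → Reflectsᵗ (¬ P) (ifᵗ t then nil else ttᵗ)
  negate (yesᵗ p) = noᵗ λ ¬p → ¬p p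
  negate (noᵗ ¬p) = yesᵗ ¬p

_∧′_ : Formula → Formula → Formula
φ ∧′ ψ = record
  { test    = if′ (test φ) (test ψ) nil′
  ; Meaning = λ ρ → Meaning φ ρ × Meaning ψ ρ
  ; correct = λ ρ → and (correct φ ρ) (correct ψ ρ) }
  where
  and : ∀ {P Q s t} → Reflectsᵗ P s → Reflectsᵗ Q t → Reflectsᵗ (P × Q) (ifᵗ s then t else nil)
  and (yesᵗ p) q = reflect-map (p ,_) proj₂ q
  and (noᵗ ¬p) q = noᵗ (¬p ∘ proj₁)

_∨′_ : Formula → Formula → Formula
φ ∨′ ψ = record
  { test    = if′ (test φ) (nil′ ∙′ nil′) (test ψ)
  ; Meaning = λ ρ → Meaning φ ρ ⊎ Meaning ψ ρ
  ; correct = λ ρ → or (correct φ ρ) (correct ψ ρ) }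
  where
  or : ∀ {P Q s t} → Reflectsᵗ P s → Reflectsᵗ Q t → Reflectsᵗ (P ⊎ Q) (ifᵗ s then ttᵗ else t)
  or (yesᵗ p) q = yesᵗ (inj₁ p)
  or (noᵗ ¬p) q = reflect-map inj₂ [ (λ p → contradiction p ¬p) , id ]′ q

_[_]′ : Formula → Fn → Formula
φ [ f ]′ = record
  { test    = test φ ∘′ f
  ; Meaning = λ ρ → Meaning φ (sem f ρ)
  ; correct = λ ρ → correct φ (sem f ρ) }

module _ (φ : Formula) where

  private
    here? : Fn
    here? = test φ ∘′ (first ∙′ env)

  any′ : Fn
  any′ = fold′ nil′ (if′ here? (nil′ ∙′ nil′) recʳ) (K 3) small
    where
    small : ∀ a b t e → size (ifᵗ sem (test φ) (hd t ∙ e) then ttᵗ else b) ≤ size a + size b + 3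
    small a b t e with sem (test φ) (hd t ∙ e)
    ... | nil   = ≤-trans (m≤n+m (size b) (size a)) (m≤m+n _ 3)
    ... | _ ∙ _ = m≤n+m 3 (size a + size b)

  any′-reflects : ∀ t e → Reflectsᵗ (Σ[ x ∈ Tree ] (x ∈ᵗ t × Meaning φ (x ∙ e)))
                                   (sem any′ (t ∙ e))
  any′-reflects nil     e = noᵗ λ ()
  any′-reflects (x ∙ t) e with sem (test φ) (x ∙ e) | correct φ (x ∙ e)
  ... | _ | yesᵗ p = yesᵗ (x , here refl , p)
  ... | _ | noᵗ ¬p = reflect-map (λ (y , y∈ , p) → y , there y∈ , p)
    (λ { (_ , here refl , p) → contradiction p ¬p ; (y , there y∈ , p) → y , y∈ , p })
    (any′-reflects t e)

  filter′ : Fn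
  filter′ = fold′ nil′ (if′ here? (first ∙′ recʳ) recʳ) (K 1 ⊕ 𝕏) small
    where
    small : ∀ a b t e → size (ifᵗ sem (test φ) (hd t ∙ e) then hd t ∙ b else b) ≤
                        size a + size b + suc (size (t ∙ e))
    small a b t e with sem (test φ) (hd t ∙ e)
    ... | nil   = ≤-trans (m≤n+m (size b) (size a)) (m≤m+n _ _)
    ... | _ ∙ _ = ≤-trans (≤-reflexive (+-comm (suc (size (hd t))) (size b)))
                    (+-mono-≤ (m≤n+m (size b) (size a))
                      (s≤s (≤-trans (hd-size t) (hd-size (t ∙ e)))))

  filterᵗ : Tree → Tree → Tree
  filterᵗ e t = sem filter′ (t ∙ e)

  filterᵗ-yes : ∀ {e x} t → Meaning φ (x ∙ e) → filterᵗ e (x ∙ t) ≡ x ∙ filterᵗ e t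
  filterᵗ-yes {e} {x} t p with sem (test φ) (x ∙ e) | correct φ (x ∙ e)
  ... | _ | yesᵗ _ = refl
  ... | _ | noᵗ ¬p = contradiction p ¬p

  filterᵗ-no : ∀ {e x} t → ¬ Meaning φ (x ∙ e) → filterᵗ e (x ∙ t) ≡ filterᵗ e t
  filterᵗ-no {e} {x} t ¬p with sem (test φ) (x ∙ e) | correct φ (x ∙ e)
  ... | _ | yesᵗ p = contradiction p ¬p
  ... | _ | noᵗ _  = refl

  ∈-filterᵗ⁺ : ∀ {e x} t → x ∈ᵗ t → Meaning φ (x ∙ e) → x ∈ᵗ filterᵗ e t
  ∈-filterᵗ⁺ {e} (y ∙ t) x∈ p with sem (test φ) (y ∙ e) | correct φ (y ∙ e) | x∈
  ... | _ | yesᵗ _ | here refl = here refl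
  ... | _ | noᵗ ¬p | here refl = contradiction p ¬p
  ... | _ | yesᵗ _ | there x∈  = there (∈-filterᵗ⁺ t x∈ p)
  ... | _ | noᵗ _  | there x∈  = ∈-filterᵗ⁺ t x∈ p

  ∈-filterᵗ⁻ : ∀ {e x} t → x ∈ᵗ filterᵗ e t → x ∈ᵗ t × Meaning φ (x ∙ e)
  ∈-filterᵗ⁻ {e} (y ∙ t) x∈ with sem (test φ) (y ∙ e) | correct φ (y ∙ e) | x∈
  ... | _ | yesᵗ p | here refl = here refl , p
  ... | _ | yesᵗ _ | there x∈  with x∈t , p ← ∈-filterᵗ⁻ t x∈ = there x∈t , p
  ... | _ | noᵗ _  | x∈        with x∈t , p ← ∈-filterᵗ⁻ t x∈ = there x∈t , p

  filterᵗ-size : ∀ e t → size (filterᵗ e t) ≤ size t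
  filterᵗ-size e nil     = ≤-refl
  filterᵗ-size e (x ∙ t) with sem (test φ) (x ∙ e)
  ... | nil   = ≤-trans (filterᵗ-size e t) (tl-size (x ∙ t))
  ... | _ ∙ _ = s≤s (+-monoʳ-≤ (size x) (filterᵗ-size e t))

  filterᵗ-shrinks : ∀ e t → filterᵗ e t ≡ t ⊎ len (filterᵗ e t) < len t
  filterᵗ-shrinks e nil     = inj₁ refl
  filterᵗ-shrinks e (x ∙ t) with sem (test φ) (x ∙ e) | filterᵗ-shrinks e t
  ... | nil   | inj₁ eq = inj₂ (s≤s (≤-reflexive (cong len eq)))
  ... | nil   | inj₂ lt = inj₂ (m≤n⇒m≤1+n lt)
  ... | _ ∙ _ | inj₁ eq = inj₁ (cong (x ∙_) eq)
  ... | _ ∙ _ | inj₂ lt = inj₂ (s≤s lt)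

∃′ : Fn → Formula → Formula
∃′ L φ = record
  { test    = any′ φ ∘′ (L ∙′ id′)
  ; Meaning = λ ρ → Σ[ x ∈ Tree ] (x ∈ᵗ sem L ρ × Meaning φ (x ∙ ρ))
  ; correct = λ ρ → any′-reflects φ (sem L ρ) ρ }

_∈′_ _∉′_ : Fn → Fn → Formula
f ∈′ L = record
  { test    = test found
  ; Meaning = λ ρ → sem f ρ ∈ᵗ sem L ρ
  ; correct = λ ρ → reflect-map (λ { (_ , x∈ , refl) → x∈ }) (λ x∈ → _ , x∈ , refl)
                                (correct found ρ) }
  -- The bound entry has been pushed in front, so f must skip it.
  where found = ∃′ L (v 0 ≡′ f ∘′ tail′)
f ∉′ L = ¬′ (f ∈′ L)

-- Concatenation, subtrees and products

append′ : Fn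
append′ = fold′ id′ (first ∙′ recʳ) (K 1 ⊕ 𝕏) λ a b t e →
  ≤-trans (≤-reflexive (+-comm (suc (size (hd t))) (size b)))
          (+-mono-≤ (m≤n+m (size b) (size a)) (s≤s (≤-trans (hd-size t) (hd-size (t ∙ e)))))

append-elems : ∀ s t → elems (sem append′ (s ∙ t)) ≡ elems s ++ elems t
append-elems nil     t = refl
append-elems (x ∙ s) t = cong (x ∷_) (append-elems s t)

append-size : ∀ x → size (sem append′ x) ≤ size x
append-size nil             = ≤-refl
append-size (nil ∙ t)       = m≤n+m (size t) 2
append-size ((x ∙ s) ∙ t) = s≤s (≤-trans (+-monoʳ-≤ (size x) (append-size (s ∙ t)))
  (≤-reflexive (trans (+-suc (size x) _) (cong suc (sym (+-assoc (size x) (size s) (size t)))))))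

subtrees′ : Fn
subtrees′ = fold′ (nil′ ∙′ nil′) (cell ∙′ (append′ ∘′ head′)) (K 2 ⊕ 𝕏) small ∘′ (id′ ∙′ nil′)
  where
  small : ∀ a b t e → suc (size t + size (sem append′ (a ∙ b))) ≤ size a + size b + suc (suc (size (t ∙ e)))
  small a b t e = begin
    suc (size t + size (sem append′ (a ∙ b)))
      ≤⟨ s≤s (+-mono-≤ (hd-size (t ∙ e)) (append-size (a ∙ b))) ⟩
    suc (size (t ∙ e) + suc (size a + size b))
      ≡⟨ cong suc (+-suc (size (t ∙ e)) _) ⟩
    2 + (size (t ∙ e) + (size a + size b))
      ≡⟨ +-comm (2 + size (t ∙ e)) (size a + size b) ⟩
    size a + size b + (2 + size (t ∙ e)) ∎
    where open ≤-Reasoning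

subtrees : Tree → Tree
subtrees = sem subtrees′

-- Concepts, axioms, names and lists are all trees, so this one condition puts their components,
-- down to the names, into `U`.
Closed : Tree → Set
Closed U = ∀ {x y} → (x ∙ y) ∈ᵗ U → x ∈ᵗ U × y ∈ᵗ U

subtrees-elems : ∀ s t → elems (subtrees (s ∙ t)) ≡
                         (s ∙ t) ∷ elems (subtrees s) ++ elems (subtrees t)
subtrees-elems s t = cong ((s ∙ t) ∷_) (append-elems (subtrees s) (subtrees t))

subtrees-refl : ∀ t → t ∈ᵗ subtrees t
subtrees-refl nil     = here refl
subtrees-refl (s ∙ t) = here refl

private
  ∈-subtrees⁻ : ∀ {x} s t → x ∈ᵗ subtrees (s ∙ t) →
                x ≡ s ∙ t ⊎ (x ∈ᵗ subtrees s ⊎ x ∈ᵗ subtrees t)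
  ∈-subtrees⁻ {x} s t x∈ with subst (x ∈_) (subtrees-elems s t) x∈
  ... | here eq  = inj₁ eq
  ... | there x∈ = inj₂ (∈-++⁻ (elems (subtrees s)) x∈)

  subtrees-left : ∀ {x} s t → x ∈ᵗ subtrees s → x ∈ᵗ subtrees (s ∙ t)
  subtrees-left {x} s t x∈ = subst (x ∈_) (sym (subtrees-elems s t)) (there (∈-++⁺ˡ x∈))

  subtrees-right : ∀ {x} s t → x ∈ᵗ subtrees t → x ∈ᵗ subtrees (s ∙ t)
  subtrees-right {x} s t x∈ =
    subst (x ∈_) (sym (subtrees-elems s t)) (there (∈-++⁺ʳ (elems (subtrees s)) x∈))

subtrees-closed : ∀ t → Closed (subtrees t)
subtrees-closed nil     (here ())
subtrees-closed nil     (there ())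
subtrees-closed (s ∙ t) xy∈ with ∈-subtrees⁻ s t xy∈
... | inj₁ refl = subtrees-left s t (subtrees-refl s) , subtrees-right s t (subtrees-refl t)
... | inj₂ (inj₁ xy∈) with x∈ , y∈ ← subtrees-closed s xy∈ =
  subtrees-left s t x∈ , subtrees-left s t y∈
... | inj₂ (inj₂ xy∈) with x∈ , y∈ ← subtrees-closed t xy∈ =
  subtrees-right s t x∈ , subtrees-right s t y∈

closed-elems : ∀ {U} → Closed U → ∀ t → t ∈ᵗ U → ∀ {x} → x ∈ᵗ t → x ∈ᵗ U
closed-elems cl (_ ∙ t) t∈ (here refl) = proj₁ (cl t∈)
closed-elems cl (_ ∙ t) t∈ (there x∈)  = closed-elems cl t (proj₂ (cl t∈)) x∈

private
  pairs′ : Fn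
  pairs′ = fold′ tail′ (((head′ ∘′ env) ∙′ first) ∙′ recʳ) (K 2 ⊕ 𝕏) λ a b t e → begin
      suc (suc (size (hd e) + size (hd t)) + size b)
        ≤⟨ s≤s (s≤s (+-monoˡ-≤ (size b) (+-mono-≤ (hd-size e) (hd-size t)))) ⟩
      suc (suc (size e + size t) + size b)
        ≡⟨ cong (λ i → 2 + (i + size b)) (+-comm (size e) (size t)) ⟩
      suc (size (t ∙ e)) + size b
        ≤⟨ n≤1+n _ ⟩
      2 + size (t ∙ e) + size b
        ≡⟨ +-comm (2 + size (t ∙ e)) (size b) ⟩
      size b + (2 + size (t ∙ e))
        ≤⟨ +-monoˡ-≤ (2 + size (t ∙ e)) (m≤n+m (size b) (size a)) ⟩
      size a + size b + (2 + size (t ∙ e)) ∎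
    where open ≤-Reasoning

  pairs-elems : ∀ t x b → elems (sem pairs′ (t ∙ (x ∙ b))) ≡ map (x ∙_) (elems t) ++ elems b
  pairs-elems nil     x b = refl
  pairs-elems (y ∙ t) x b = cong ((x ∙ y) ∷_) (pairs-elems t x b)

  pairs-size : ∀ t x b → size (sem pairs′ (t ∙ (x ∙ b))) ≤ size t * (2 + size x) + size b
  pairs-size nil     x b = m≤n+m (size b) _
  pairs-size (y ∙ t) x b = begin
    2 + (size x + size y) + size (sem pairs′ (t ∙ (x ∙ b)))
      ≤⟨ +-mono-≤ (+-monoʳ-≤ (2 + size x) (m≤m*n (size y) (2 + size x))) (pairs-size t x b) ⟩
    2 + size x + size y * (2 + size x) + (size t * (2 + size x) + size b)
      ≡⟨ +-assoc (2 + size x + size y * (2 + size x)) (size t * (2 + size x)) (size b) ⟨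
    2 + size x + size y * (2 + size x) + size t * (2 + size x) + size b
      ≡⟨ cong (_+ size b) (+-assoc (2 + size x) (size y * (2 + size x)) _) ⟩
    2 + size x + (size y * (2 + size x) + size t * (2 + size x)) + size b
      ≡⟨ cong (λ i → 2 + size x + i + size b) (*-distribʳ-+ (2 + size x) (size y) (size t)) ⟨
    size (y ∙ t) * (2 + size x) + size b ∎
    where open ≤-Reasoning

product′ : Fn
product′ = fold′ nil′ (pairs′ ∘′ (env ∙′ (first ∙′ recʳ))) (𝕏 ⊗ (K 2 ⊕ 𝕏)) λ a b t e → begin
    size (sem pairs′ (e ∙ (hd t ∙ b)))
      ≤⟨ pairs-size e (hd t) b ⟩
    size e * (2 + size (hd t)) + size b
      ≤⟨ +-mono-≤ (*-mono-≤ (tl-size (t ∙ e)) (s≤s (s≤s (≤-trans (hd-size t) (hd-size (t ∙ e))))))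
                  (m≤n+m (size b) (size a)) ⟩
    size (t ∙ e) * (2 + size (t ∙ e)) + (size a + size b)
      ≡⟨ +-comm _ (size a + size b) ⟩
    size a + size b + size (t ∙ e) * (2 + size (t ∙ e)) ∎
  where open ≤-Reasoning

infixr 6 _⊠_
_⊠_ : Tree → Tree → Tree
s ⊠ t = sem product′ (s ∙ t)

∈-⊠⁺ : ∀ {x y} s t → x ∈ᵗ s → y ∈ᵗ t → (x ∙ y) ∈ᵗ (s ⊠ t)
∈-⊠⁺ {x} {y} (x′ ∙ s) t x∈ y∈ =
  subst ((x ∙ y) ∈_) (sym (pairs-elems t x′ (s ⊠ t))) (cases x∈)
  where
  cases : x ∈ᵗ (x′ ∙ s) → (x ∙ y) ∈ (map (x′ ∙_) (elems t) ++ elems (s ⊠ t))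
  cases (here refl) = ∈-++⁺ˡ (∈-map⁺ (x′ ∙_) y∈)
  cases (there x∈)  = ∈-++⁺ʳ (map (x′ ∙_) (elems t)) (∈-⊠⁺ s t x∈ y∈)

∈-⊠⁻ : ∀ {x y} s t → (x ∙ y) ∈ᵗ (s ⊠ t) → x ∈ᵗ s × y ∈ᵗ t
∈-⊠⁻ (x′ ∙ s) t xy∈
  with ∈-++⁻ (map (x′ ∙_) (elems t)) (subst (_ ∈_) (pairs-elems t x′ (s ⊠ t)) xy∈)
... | inj₂ xy∈′ with x∈ , y∈ ← ∈-⊠⁻ s t xy∈′ = there x∈ , y∈
... | inj₁ xy∈′ with _ , y∈ , refl ← ∈-map⁻ (x′ ∙_) xy∈′ = here refl , y∈

-- The least set D of candidates closed under "ψ holds of x when the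
-- candidates outside D are those in R", with ψ antitone in R, is found by
-- repeatedly removing from the list R of all candidates those satisfying ψ.
-- Each round but the last removes something, so as many rounds as there are
-- candidates suffice.  What is computed is the complement of D.
module Fixpoint (ψ : Formula) where

  private
    remove′ step : Fn
    remove′ = filter′ (¬′ ψ)
    step = remove′ ∘′ (recʳ ∙′ (recʳ ∙′ (tail′ ∘′ env)))

  remaining′ : Fn
  -- Filtering never enlarges the list, so the allowance for growth is 0. The candidates are
  -- supplied twice: as the counter of rounds and as the initial list.
  remaining′ = fold′ head′ step (K 0) (λ a b t e →
    ≤-trans (filterᵗ-size (¬′ ψ) (b ∙ tl e) b)
            (≤-trans (m≤n+m (size b) (size a)) (m≤m+n _ 0))) ∘′ (head′ ∙′ id′)

  module Result (cand e : Tree) where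

    remaining : Tree
    remaining = sem remaining′ (cand ∙ e)

    Derived : Tree → Set
    Derived x = x ∈ᵗ cand × x ∉ᵗ remaining

    private
      remove : Tree → Tree
      remove R = filterᵗ (¬′ ψ) (R ∙ e) R

      round : Tree → Tree
      round = foldᵗ hd (sem step) (cand ∙ e)

      -- Once a round removes nothing, all later rounds repeat it; until then every entry of the
      -- counter c has cost the list at least one entry.
      shrinks : ∀ c → remove (round c) ≡ round c ⊎ len c + len (round c) ≤ len cand
      shrinks nil     = inj₂ ≤-refl
      shrinks (x ∙ c) with shrinks c
      ... | inj₁ eq = inj₁ (cong remove eq)
      ... | inj₂ le with filterᵗ-shrinks (¬′ ψ) (round c ∙ e) (round c)
      ...   | inj₁ eq = inj₁ (cong remove eq)
      ...   | inj₂ lt = inj₂ (begin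
        suc (len c) + len (remove (round c))  ≡⟨ +-suc (len c) _ ⟨
        len c + suc (len (remove (round c)))  ≤⟨ +-monoʳ-≤ (len c) lt ⟩
        len c + len (round c)                 ≤⟨ le ⟩
        len cand                              ∎)
        where open ≤-Reasoning

      empty-stable : ∀ R → len R ≤ 0 → remove R ≡ R
      empty-stable nil _ = refl

      stable : remove remaining ≡ remaining
      stable with shrinks cand
      ... | inj₁ eq = eq
      ... | inj₂ le = empty-stable remaining
        (+-cancelˡ-≤ (len cand) _ 0 (≤-trans le (≤-reflexive (sym (+-identityʳ _)))))

    closed : ∀ {x} → Meaning ψ (x ∙ (remaining ∙ e)) → x ∉ᵗ remaining
    closed {x} p x∈ = proj₂ (∈-filterᵗ⁻ (¬′ ψ) remaining (subst (x ∈ᵗ_) (sym stable) x∈)) p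

    -- A candidate missing at the end was removed in some round, when ψ held relative to the list R
    -- of that moment. Whatever was missing from R had been removed earlier, so the proof is by
    -- induction on rounds.
    induction : (D : Tree → Set) →
      (∀ R {x} → x ∈ᵗ cand → (∀ {y} → y ∈ᵗ cand → y ∉ᵗ R → D y) →
        Meaning ψ (x ∙ (R ∙ e)) → D x) →
      ∀ {x} → Derived x → D x
    induction D step (x∈ , x∉) = go cand x∈ x∉
      where
      go : ∀ c {x} → x ∈ᵗ cand → x ∉ᵗ round c → D x
      go nil     x∈ x∉ = contradiction x∈ x∉
      go (_ ∙ c) {x} x∈ x∉ with x ∈? elems (round c)
      ... | no x∉′  = go c x∈ x∉′
      ... | yes x∈′ = step (round c) x∈ (go c)
        (decidable-stable (Meaning? ψ _) λ ¬p → x∉ (∈-filterᵗ⁺ (¬′ ψ) (round c) x∈′ ¬p))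

-- Saturation

list′ : List Fn → Fn
list′ []       = nil′
list′ (f ∷ fs) = f ∙′ list′ fs

tagged′ : ℕ → List Fn → Fn
tagged′ i fs = const′ (numeral i) ∙′ list′ fs

⊤ᵗ : Tree
⊤ᵗ = tagged 1 []

atomᵗ : Tree → Tree
atomᵗ n = tagged 0 (n ∷ [])

_⊓ᵗ_ ∃ᵗ roleᵗ : Tree → Tree → Tree
C ⊓ᵗ D  = tagged 2 (C ∷ D ∷ [])
∃ᵗ r C  = tagged 3 (r ∷ C ∷ [])
roleᵗ r s = tagged 2 (r ∷ s ∷ [])

_⊓′_ ∃ᶜ′ : Fn → Fn → Fn
f ⊓′ g = tagged′ 2 (f ∷ g ∷ [])
∃ᶜ′ f g = tagged′ 3 (f ∷ g ∷ [])

-- A tree that encodes no name: it serves as the role of the root element,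
-- which thereby is not in the range of any role.
ρ₀ : Tree
ρ₀ = ((nil ∙ nil) ∙ nil) ∙ nil

ρ₀≢encName : ∀ {k} (n : Name k) → encName n ≢ ρ₀
ρ₀≢encName (name [])          ()
ρ₀≢encName (name (false ∷ w)) ()
ρ₀≢encName (name (true  ∷ w)) ()

decBool : Tree → Bool
decBool nil     = false
decBool (_ ∙ _) = true

decName : ∀ {k} → Tree → Name k
decName t = name (map decBool (elems t))

-- Total, with `⊤ᶜ` as default: derivations range over arbitrary trees of `U`, and their soundness
-- in a model is stated through this decoding.
decEL : Tree → EL
decEL (nil ∙ (n ∙ _))                             = atom (decName n)
decEL ((nil ∙ (nil ∙ nil)) ∙ (C ∙ (D ∙ _)))         = decEL C ⊓ decEL D
decEL ((nil ∙ (nil ∙ (nil ∙ nil))) ∙ (r ∙ (C ∙ _))) = ∃ᶜ (decName r) (decEL C)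
decEL _                                             = ⊤ᶜ

decLHS : Tree → LHS
decLHS (nil ∙ (C ∙ _))                     = con (decEL C)
decLHS ((nil ∙ nil) ∙ (r ∙ _))             = ran (decName r)
decLHS ((nil ∙ (nil ∙ nil)) ∙ (r ∙ (C ∙ _))) = ran (decName r) ⊓ᴸ decEL C
decLHS _                                   = con ⊤ᶜ

decInclusion : Tree → Inclusion
decInclusion (nil ∙ (E ∙ (C ∙ _)))                 = decLHS E ⊑ decEL C
decInclusion ((nil ∙ nil) ∙ (C ∙ (D ∙ _)))         = decEL C ≣ decEL D
decInclusion ((nil ∙ (nil ∙ nil)) ∙ (r ∙ (s ∙ _))) = decName r ⊑ᴿ decName s
decInclusion _                                     = ⊤ᶜ ≣ ⊤ᶜ

decSymbol : Tree → Symbol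
decSymbol (nil ∙ (n ∙ _)) = inj₁ (decName n)
decSymbol t               = inj₂ (decName (hd (tl t)))

elems-encList : ∀ {A : Set} (enc : A → Tree) xs → elems (encList enc xs) ≡ map enc xs
elems-encList enc []       = refl
elems-encList enc (x ∷ xs) = cong (enc x ∷_) (elems-encList enc xs)

decBool-enc : ∀ b → decBool (encBool b) ≡ b
decBool-enc false = refl
decBool-enc true  = refl

decName-enc : ∀ {k} (n : Name k) → decName (encName n) ≡ n
decName-enc (name w) = cong name (begin
  map decBool (elems (encList encBool w))  ≡⟨ cong (map decBool) (elems-encList encBool w) ⟩
  map decBool (map encBool w)              ≡⟨ map-∘ w ⟨
  map (decBool ∘ encBool) w                ≡⟨ map-cong decBool-enc w ⟩
  map id w                                 ≡⟨ map-id w ⟩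
  w                                        ∎)
  where open ≡-Reasoning

decEL-enc : ∀ C → decEL (encEL C) ≡ C
decEL-enc (atom A) = cong atom (decName-enc A)
decEL-enc ⊤ᶜ       = refl
decEL-enc (C ⊓ D)  = cong₂ _⊓_ (decEL-enc C) (decEL-enc D)
decEL-enc (∃ᶜ r C) = cong₂ ∃ᶜ (decName-enc r) (decEL-enc C)

decLHS-enc : ∀ E → decLHS (encLHS E) ≡ E
decLHS-enc (con C)      = cong con (decEL-enc C)
decLHS-enc (ran r)      = cong ran (decName-enc r)
decLHS-enc (ran r ⊓ᴸ C) = cong₂ ran_⊓ᴸ_ (decName-enc r) (decEL-enc C)

decInclusion-enc : ∀ α → decInclusion (encInclusion α) ≡ α
decInclusion-enc (E ⊑ C)  = cong₂ _⊑_ (decLHS-enc E) (decEL-enc C)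
decInclusion-enc (C ≣ D)  = cong₂ _≣_ (decEL-enc C) (decEL-enc D)
decInclusion-enc (r ⊑ᴿ s) = cong₂ _⊑ᴿ_ (decName-enc r) (decName-enc s)

decSymbol-enc : ∀ σ → decSymbol (encSymbol σ) ≡ σ
decSymbol-enc (inj₁ A) = cong inj₁ (decName-enc A)
decSymbol-enc (inj₂ r) = cong inj₂ (decName-enc r)

square′ : Fn → Fn
square′ f = product′ ∘′ (f ∙′ f)

subs-rule ders-rule reach-rule nonsim-rule : Formula

-- In the comments, variables are listed from v 0 on; x is the candidate and R
-- the list of the candidates not yet derived.  Rs, Rd and Rr are the results
-- for role subsumption, derivability and reachability, and P is U ⊠ U.

-- Variables: x R T U.
subs-rule = ∃′ (v 3) (∃′ (v 4)
  (v 2 ≡′ v 1 ∙′ v 0 ∧′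
    (v 1 ≡′ v 0 ∧′ ¬′ (v 0 ≡′ const′ ρ₀)
    ∨′ ∃′ (v 5) (tagged′ 2 (v 0 ∷ v 1 ∷ []) ∈′ v 5 ∧′ v 2 ∙′ v 0 ∉′ v 4))))

-- Variables: x R Rs T U.
ders-rule = ∃′ (v 4) (∃′ (v 5) (∃′ (v 6)
  (v 3 ≡′ (v 2 ∙′ v 1) ∙′ v 0 ∧′
    (v 0 ≡′ v 1
    ∨′ v 0 ≡′ const′ ⊤ᵗ
    ∨′ ∃′ (v 7) (∃′ (v 8)
         ((v 0 ≡′ v 2 ⊓′ v 1 ∨′ v 0 ≡′ v 1 ⊓′ v 2) ∧′ (v 4 ∙′ v 3) ∙′ v 0 ∉′ v 6))
    ∨′ ∃′ (v 7) (∃′ (v 8)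
         (v 2 ≡′ v 1 ⊓′ v 0 ∧′ (v 4 ∙′ v 3) ∙′ v 1 ∉′ v 6 ∧′ (v 4 ∙′ v 3) ∙′ v 0 ∉′ v 6))
    ∨′ ∃′ (v 7) (∃′ (v 8) (∃′ (v 9) (∃′ (v 10)
         (v 4 ≡′ ∃ᶜ′ (v 3) (v 2) ∧′ ∃ᶜ′ (v 1) (v 0) ∈′ v 11 ∧′
          (v 6 ∙′ v 5) ∙′ ∃ᶜ′ (v 1) (v 0) ∉′ v 8 ∧′ v 1 ∙′ v 3 ∉′ v 9 ∧′
          (v 1 ∙′ v 0) ∙′ v 2 ∉′ v 8))))
    ∨′ ∃′ (v 7)
         ((tagged′ 0 (tagged′ 0 (v 0 ∷ []) ∷ v 1 ∷ []) ∈′ v 7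
           ∨′ tagged′ 1 (v 0 ∷ v 1 ∷ []) ∈′ v 7
           ∨′ tagged′ 1 (v 1 ∷ v 0 ∷ []) ∈′ v 7)
          ∧′ (v 3 ∙′ v 2) ∙′ v 0 ∉′ v 5)
    ∨′ ∃′ (v 7) (tagged′ 0 (tagged′ 1 (v 0 ∷ []) ∷ v 1 ∷ []) ∈′ v 7 ∧′ v 3 ∙′ v 0 ∉′ v 6)
    ∨′ ∃′ (v 7) (∃′ (v 8)
         (tagged′ 0 (tagged′ 2 (v 1 ∷ v 0 ∷ []) ∷ v 2 ∷ []) ∈′ v 8 ∧′
          v 4 ∙′ v 1 ∉′ v 7 ∧′ (v 4 ∙′ v 3) ∙′ v 0 ∉′ v 6))))))

-- Variables: x R Rd root U P.
reach-rule = ∃′ (v 4) (∃′ (v 5)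
  (v 2 ≡′ v 1 ∙′ v 0 ∧′
    (v 2 ≡′ v 5
    ∨′ ∃′ (v 7)
         (v 0 ∉′ v 4 ∧′ ∃ᶜ′ (v 2) (v 1) ∈′ v 7 ∧′ v 0 ∙′ ∃ᶜ′ (v 2) (v 1) ∉′ v 5))))

-- Variables: x R Rs₁ Rd₁ Rs₂ Rd₂ S U P.
nonsim-rule = ∃′ (v 8) (∃′ (v 9)
  (v 2 ≡′ v 1 ∙′ v 0 ∧′
    (∃′ (v 9)
       (tagged′ 0 (v 0 ∷ []) ∈′ v 9 ∧′ v 2 ∙′ tagged′ 0 (v 0 ∷ []) ∉′ v 6 ∧′
        v 1 ∙′ tagged′ 0 (v 0 ∷ []) ∈′ v 8)
    ∨′ ∃′ (v 9) (∃′ (v 10)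
         (∃ᶜ′ (v 1) (v 0) ∈′ v 11 ∧′ v 3 ∙′ ∃ᶜ′ (v 1) (v 0) ∉′ v 7 ∧′
          -- Conjunctions of roles are nonempty, so an edge matters only if some role name of the
          -- signature holds along it.
          ∃′ (v 11) (tagged′ 1 (v 0 ∷ []) ∈′ v 11 ∧′ v 2 ∙′ v 0 ∉′ v 7) ∧′
          -- Membership in R means "not yet known to be dissimilar". No answering edge may lead to
          -- such an element; under the negation this is antitone in R.
          ¬′ ∃′ (v 11) (∃′ (v 12)
            (∃ᶜ′ (v 1) (v 0) ∈′ v 13 ∧′ v 4 ∙′ ∃ᶜ′ (v 1) (v 0) ∉′ v 11 ∧′
             (v 3 ∙′ v 2) ∙′ (v 1 ∙′ v 0) ∈′ v 7 ∧′
             ¬′ ∃′ (v 13)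
               (tagged′ 1 (v 0 ∷ []) ∈′ v 13 ∧′ v 4 ∙′ v 0 ∉′ v 9 ∧′ v 2 ∙′ v 0 ∈′ v 11))))))))

module Subs   = Fixpoint subs-rule
module Ders   = Fixpoint ders-rule
module Reachs = Fixpoint reach-rule
module Sims   = Fixpoint nonsim-rule

subs′ ders′ reach′ sims′ : Fn
subs′  = Subs.remaining′ ∘′ (square′ (v 1) ∙′ id′)
ders′  = Ders.remaining′ ∘′ ((product′ ∘′ (square′ (v 2) ∙′ v 2)) ∙′ id′)
reach′ = Reachs.remaining′ ∘′ (v 3 ∙′ id′)
sims′  = Sims.remaining′ ∘′ (square′ (v 6) ∙′ id′)

-- An element r ∙ C stands for an r-successor in C.  U consists of all subtrees
-- of the input, and only concepts in U are derived, so that there are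
-- polynomially many facts.
module Completion (T U : Tree) (U-closed : Closed U) where

  data Sub : Tree → Tree → Set where
    refl : ∀ {r} → r ∈ᵗ U → r ≢ ρ₀ → Sub r r
    step : ∀ {r q s} → s ∈ᵗ U → Sub r q → roleᵗ q s ∈ᵗ T → Sub r s

  Rs : Tree
  Rs = sem subs′ (T ∙ (U ∙ nil))

  open Subs.Result (U ⊠ U) (T ∙ (U ∙ nil)) using () renaming (closed to subs-closed; induction to subs-ind)

  Sub-∈ : ∀ {r s} → Sub r s → r ∈ᵗ U × s ∈ᵗ U
  Sub-∈ (refl r∈ _)   = r∈ , r∈
  Sub-∈ (step s∈ p _) = proj₁ (Sub-∈ p) , s∈

  Sub-complete : ∀ {r s} → Sub r s → (r ∙ s) ∉ᵗ Rs
  Sub-complete (refl r∈ r≢) = subs-closed (_ , r∈ , _ , r∈ , refl , inj₁ (refl , r≢))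
  Sub-complete (step s∈ p α∈) = subs-closed
    (_ , proj₁ (Sub-∈ p) , _ , s∈ , refl , inj₂ (_ , proj₂ (Sub-∈ p) , α∈ , Sub-complete p))

  private
    Subᵗ : Tree → Set
    Subᵗ nil     = ⊥
    Subᵗ (r ∙ s) = Sub r s

  Sub-sound : ∀ {r s} → r ∈ᵗ U → s ∈ᵗ U → (r ∙ s) ∉ᵗ Rs → Sub r s
  Sub-sound r∈ s∈ rs∉ = subs-ind Subᵗ
    (λ { R x∈ ih (r , r∈ , s , s∈ , refl , inj₁ (refl , r≢)) → refl r∈ r≢
       ; R x∈ ih (r , r∈ , s , s∈ , refl , inj₂ (q , q∈ , α∈ , rq∉)) →
           step s∈ (ih (∈-⊠⁺ U U r∈ q∈) rq∉) α∈ })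
    (∈-⊠⁺ U U r∈ s∈ , rs∉)

  Sub? : ∀ {r s} → r ∈ᵗ U → s ∈ᵗ U → Dec (Sub r s)
  Sub? {r} {s} r∈ s∈ with (r ∙ s) ∈? elems Rs
  ... | yes rs∈ = no λ p → Sub-complete p rs∈
  ... | no  rs∉ = yes (Sub-sound r∈ s∈ rs∉)

  -- The rule `∃-intro` looks up what holds at the successor under its full name `q ∙ C`, and so
  -- takes into account the range axioms that apply to q.
  data Der : Tree → Tree → Set where
    init : ∀ {r C} → r ∈ᵗ U → C ∈ᵗ U → Der (r ∙ C) C
    top  : ∀ {r C} → r ∈ᵗ U → C ∈ᵗ U → ⊤ᵗ ∈ᵗ U → Der (r ∙ C) ⊤ᵗ
    ⊓-elimˡ : ∀ {X C D} → Der X (C ⊓ᵗ D) → Der X C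
    ⊓-elimʳ : ∀ {X C D} → Der X (C ⊓ᵗ D) → Der X D
    ⊓-intro : ∀ {X C D} → (C ⊓ᵗ D) ∈ᵗ U → Der X C → Der X D → Der X (C ⊓ᵗ D)
    ∃-intro : ∀ {X q s C D} → ∃ᵗ s D ∈ᵗ U →
              Der X (∃ᵗ q C) → Sub q s → Der (q ∙ C) D → Der X (∃ᵗ s D)
    axiom-con : ∀ {X C D} → D ∈ᵗ U → tagged 0 (tagged 0 (C ∷ []) ∷ D ∷ []) ∈ᵗ T →
                Der X C → Der X D
    axiom-≣ˡ  : ∀ {X C D} → D ∈ᵗ U → tagged 1 (C ∷ D ∷ []) ∈ᵗ T → Der X C → Der X D
    axiom-≣ʳ  : ∀ {X C D} → D ∈ᵗ U → tagged 1 (D ∷ C ∷ []) ∈ᵗ T → Der X C → Der X D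
    axiom-ran : ∀ {r C s D} → D ∈ᵗ U → C ∈ᵗ U → tagged 0 (tagged 1 (s ∷ []) ∷ D ∷ []) ∈ᵗ T →
                Sub r s → Der (r ∙ C) D
    axiom-ran⊓ : ∀ {r C s E D} → D ∈ᵗ U → tagged 0 (tagged 2 (s ∷ E ∷ []) ∷ D ∷ []) ∈ᵗ T →
                 Sub r s → Der (r ∙ C) E → Der (r ∙ C) D

  private
    args : ∀ {i x y} → tagged i (x ∷ y ∷ []) ∈ᵗ U → x ∈ᵗ U × y ∈ᵗ U
    args t∈ with xs∈ ← proj₂ (U-closed t∈) with x∈ , ys∈ ← U-closed xs∈ = x∈ , proj₁ (U-closed ys∈)

  Inside : Tree → Set
  Inside nil     = ⊥
  Inside (r ∙ C) = r ∈ᵗ U × C ∈ᵗ U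

  Der-∈ : ∀ {X D} → Der X D → Inside X × D ∈ᵗ U
  Der-∈ (init r∈ C∈)           = (r∈ , C∈) , C∈
  Der-∈ (top r∈ C∈ ⊤∈)         = (r∈ , C∈) , ⊤∈
  Der-∈ (⊓-elimˡ p)            with X∈ , D∈ ← Der-∈ p = X∈ , proj₁ (args {2} D∈)
  Der-∈ (⊓-elimʳ p)            with X∈ , D∈ ← Der-∈ p = X∈ , proj₂ (args {2} D∈)
  Der-∈ (⊓-intro D∈ p _)       = proj₁ (Der-∈ p) , D∈
  Der-∈ (∃-intro D∈ p _ _)     = proj₁ (Der-∈ p) , D∈
  Der-∈ (axiom-con D∈ _ p)     = proj₁ (Der-∈ p) , D∈
  Der-∈ (axiom-≣ˡ D∈ _ p)      = proj₁ (Der-∈ p) , D∈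
  Der-∈ (axiom-≣ʳ D∈ _ p)      = proj₁ (Der-∈ p) , D∈
  Der-∈ (axiom-ran D∈ C∈ _ p)  = (proj₁ (Sub-∈ p) , C∈) , D∈
  Der-∈ (axiom-ran⊓ D∈ _ _ p)  = proj₁ (Der-∈ p) , D∈

  Rd : Tree
  Rd = sem ders′ (Rs ∙ (T ∙ (U ∙ nil)))

  open Ders.Result ((U ⊠ U) ⊠ U) (Rs ∙ (T ∙ (U ∙ nil)))
    using () renaming (closed to ders-closed; induction to ders-ind)

  -- The meaning of `ders-rule` below its three outer binders, written out; it agrees with the
  -- formula by computation, so its proofs can be handed to the fixpoint directly.
  Rule : Tree → Tree → Tree → Tree → Set
  Rule R r C D =
    D ≡ C
    ⊎ D ≡ ⊤ᵗ
    ⊎ (Σ[ E ∈ Tree ] (E ∈ᵗ U × Σ[ t ∈ Tree ] (t ∈ᵗ U ×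
        (t ≡ D ⊓ᵗ E ⊎ t ≡ E ⊓ᵗ D) × ((r ∙ C) ∙ t) ∉ᵗ R)))
    ⊎ (Σ[ E ∈ Tree ] (E ∈ᵗ U × Σ[ F ∈ Tree ] (F ∈ᵗ U ×
        D ≡ E ⊓ᵗ F × ((r ∙ C) ∙ E) ∉ᵗ R × ((r ∙ C) ∙ F) ∉ᵗ R)))
    ⊎ (Σ[ s ∈ Tree ] (s ∈ᵗ U × Σ[ E ∈ Tree ] (E ∈ᵗ U ×
       Σ[ q ∈ Tree ] (q ∈ᵗ U × Σ[ F ∈ Tree ] (F ∈ᵗ U ×
        D ≡ ∃ᵗ s E × ∃ᵗ q F ∈ᵗ U × ((r ∙ C) ∙ ∃ᵗ q F) ∉ᵗ R × (q ∙ s) ∉ᵗ Rs ×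
        ((q ∙ F) ∙ E) ∉ᵗ R)))))
    ⊎ (Σ[ E ∈ Tree ] (E ∈ᵗ U ×
        (tagged 0 (tagged 0 (E ∷ []) ∷ D ∷ []) ∈ᵗ T
         ⊎ tagged 1 (E ∷ D ∷ []) ∈ᵗ T ⊎ tagged 1 (D ∷ E ∷ []) ∈ᵗ T) ×
        ((r ∙ C) ∙ E) ∉ᵗ R))
    ⊎ (Σ[ s ∈ Tree ] (s ∈ᵗ U × tagged 0 (tagged 1 (s ∷ []) ∷ D ∷ []) ∈ᵗ T × (r ∙ s) ∉ᵗ Rs))
    ⊎ (Σ[ s ∈ Tree ] (s ∈ᵗ U × Σ[ E ∈ Tree ] (E ∈ᵗ U ×
        tagged 0 (tagged 2 (s ∷ E ∷ []) ∷ D ∷ []) ∈ᵗ T × (r ∙ s) ∉ᵗ Rs × ((r ∙ C) ∙ E) ∉ᵗ R)))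

  private
    rule-closed : ∀ {r C D} → r ∈ᵗ U → C ∈ᵗ U → D ∈ᵗ U → Rule Rd r C D → ((r ∙ C) ∙ D) ∉ᵗ Rd
    rule-closed r∈ C∈ D∈ p = ders-closed (_ , r∈ , _ , C∈ , _ , D∈ , refl , p)

  Der-complete : ∀ {X D} → Der X D → (X ∙ D) ∉ᵗ Rd
  private
    rules : ∀ {r C D} → Der (r ∙ C) D → Rule Rd r C D
  Der-complete {nil} p with () ← proj₁ (Der-∈ p)
  Der-complete {r ∙ C} p with (r∈ , C∈) , D∈ ← Der-∈ p = rule-closed r∈ C∈ D∈ (rules p)
  rules (init r∈ C∈) = inj₁ refl
  rules (top r∈ C∈ ⊤∈) = inj₂ (inj₁ refl)
  rules (⊓-elimˡ p) with t∈ ← proj₂ (Der-∈ p) =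
    inj₂ (inj₂ (inj₁ (_ , proj₂ (args {2} t∈) , _ , t∈ , inj₁ refl , Der-complete p)))
  rules (⊓-elimʳ p) with t∈ ← proj₂ (Der-∈ p) =
    inj₂ (inj₂ (inj₁ (_ , proj₁ (args {2} t∈) , _ , t∈ , inj₂ refl , Der-complete p)))
  rules (⊓-intro D∈ p q) =
    inj₂ (inj₂ (inj₂ (inj₁ (_ , proj₂ (Der-∈ p) , _ , proj₂ (Der-∈ q) , refl ,
      Der-complete p , Der-complete q))))
  rules (∃-intro D∈ p s q) with t∈ ← proj₂ (Der-∈ p) =
    inj₂ (inj₂ (inj₂ (inj₂ (inj₁ (_ , proj₂ (Sub-∈ s) , _ , proj₂ (Der-∈ q) ,
      _ , proj₁ (args {3} t∈) , _ , proj₂ (args {3} t∈) , refl , t∈ , Der-complete p ,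
      Sub-complete s , Der-complete q)))))
  rules (axiom-con D∈ α∈ p) = inj₂ (inj₂ (inj₂ (inj₂ (inj₂ (inj₁
    (_ , proj₂ (Der-∈ p) , inj₁ α∈ , Der-complete p))))))
  rules (axiom-≣ˡ D∈ α∈ p) = inj₂ (inj₂ (inj₂ (inj₂ (inj₂ (inj₁
    (_ , proj₂ (Der-∈ p) , inj₂ (inj₁ α∈) , Der-complete p))))))
  rules (axiom-≣ʳ D∈ α∈ p) = inj₂ (inj₂ (inj₂ (inj₂ (inj₂ (inj₁
    (_ , proj₂ (Der-∈ p) , inj₂ (inj₂ α∈) , Der-complete p))))))
  rules (axiom-ran D∈ C∈ α∈ s) = inj₂ (inj₂ (inj₂ (inj₂ (inj₂ (inj₂ (inj₁
    (_ , proj₂ (Sub-∈ s) , α∈ , Sub-complete s)))))))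
  rules (axiom-ran⊓ D∈ α∈ s p) = inj₂ (inj₂ (inj₂ (inj₂ (inj₂ (inj₂ (inj₂
    (_ , proj₂ (Sub-∈ s) , _ , proj₂ (Der-∈ p) , α∈ , Sub-complete s , Der-complete p)))))))

  private
    Derᵗ : Tree → Set
    Derᵗ nil     = ⊥
    Derᵗ (X ∙ D) = Der X D

    sound-step : ∀ R {r C D} → r ∈ᵗ U → C ∈ᵗ U → D ∈ᵗ U →
      (∀ {X E} → X ∈ᵗ (U ⊠ U) → E ∈ᵗ U → (X ∙ E) ∉ᵗ R → Der X E) →
      Rule R r C D → Der (r ∙ C) D
    sound-step R {r} {C} {D} r∈ C∈ D∈ ih = λ where
        (inj₁ refl) → init r∈ C∈
        (inj₂ (inj₁ refl)) → top r∈ C∈ D∈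
        (inj₂ (inj₂ (inj₁ (E , E∈ , t , t∈ , inj₁ refl , p)))) → ⊓-elimˡ (ih′ t∈ p)
        (inj₂ (inj₂ (inj₁ (E , E∈ , t , t∈ , inj₂ refl , p)))) → ⊓-elimʳ (ih′ t∈ p)
        (inj₂ (inj₂ (inj₂ (inj₁ (E , E∈ , F , F∈ , refl , p , q))))) →
          ⊓-intro D∈ (ih′ E∈ p) (ih′ F∈ q)
        (inj₂ (inj₂ (inj₂ (inj₂ (inj₁ (s , s∈ , E , E∈ , q , q∈ , F , F∈ , refl , t∈ , p , qs , p′)))))) →
          ∃-intro D∈ (ih′ t∈ p) (Sub-sound q∈ s∈ qs) (ih (∈-⊠⁺ U U q∈ F∈) E∈ p′)
        (inj₂ (inj₂ (inj₂ (inj₂ (inj₂ (inj₁ (E , E∈ , inj₁ α∈ , p))))))) → axiom-con D∈ α∈ (ih′ E∈ p)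
        (inj₂ (inj₂ (inj₂ (inj₂ (inj₂ (inj₁ (E , E∈ , inj₂ (inj₁ α∈) , p))))))) →
          axiom-≣ˡ D∈ α∈ (ih′ E∈ p)
        (inj₂ (inj₂ (inj₂ (inj₂ (inj₂ (inj₁ (E , E∈ , inj₂ (inj₂ α∈) , p))))))) →
          axiom-≣ʳ D∈ α∈ (ih′ E∈ p)
        (inj₂ (inj₂ (inj₂ (inj₂ (inj₂ (inj₂ (inj₁ (s , s∈ , α∈ , rs)))))))) →
          axiom-ran D∈ C∈ α∈ (Sub-sound r∈ s∈ rs)
        (inj₂ (inj₂ (inj₂ (inj₂ (inj₂ (inj₂ (inj₂ (s , s∈ , E , E∈ , α∈ , rs , p)))))))) →
          axiom-ran⊓ D∈ α∈ (Sub-sound r∈ s∈ rs) (ih′ E∈ p)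
      where
      ih′ : ∀ {E} → E ∈ᵗ U → ((r ∙ C) ∙ E) ∉ᵗ R → Der (r ∙ C) E
      ih′ = ih (∈-⊠⁺ U U r∈ C∈)

  Der-sound : ∀ {X D} → X ∈ᵗ (U ⊠ U) → D ∈ᵗ U → (X ∙ D) ∉ᵗ Rd → Der X D
  Der-sound X∈ D∈ XD∉ = ders-ind Derᵗ
    (λ { R x∈ ih (r , r∈ , C , C∈ , D , D∈ , refl , p) →
         sound-step R r∈ C∈ D∈ (λ X∈ E∈ → ih (∈-⊠⁺ (U ⊠ U) U X∈ E∈)) p })
    (∈-⊠⁺ (U ⊠ U) U X∈ D∈ , XD∉)

  Edge : Tree → Tree → Tree → Set
  Edge X q D = Der X (∃ᵗ q D)

  module _ (root : Tree) where

    data Reach : Tree → Set where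
      start : ∀ {r C} → r ∈ᵗ U → C ∈ᵗ U → root ≡ r ∙ C → Reach root
      next : ∀ {X q D} → Reach X → Edge X q D → Reach (q ∙ D)

    Rr : Tree
    Rr = sem reach′ (Rd ∙ (root ∙ (U ∙ ((U ⊠ U) ∙ nil))))

    open Reachs.Result (U ⊠ U) (Rd ∙ (root ∙ (U ∙ ((U ⊠ U) ∙ nil))))
      using () renaming (closed to reach-closed; induction to reach-ind)

    Reach-∈ : ∀ {X} → Reach X → X ∈ᵗ (U ⊠ U)
    Reach-∈ (start r∈ C∈ refl) = ∈-⊠⁺ U U r∈ C∈
    Reach-∈ (next _ e) with q∈ , D∈ ← args {3} (proj₂ (Der-∈ e)) = ∈-⊠⁺ U U q∈ D∈

    Reach-complete : ∀ {X} → Reach X → X ∉ᵗ Rr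
    Reach-complete (start r∈ C∈ refl) = reach-closed (_ , r∈ , _ , C∈ , refl , inj₁ refl)
    Reach-complete (next p e) with q∈ , D∈ ← args {3} (proj₂ (Der-∈ e)) =
      reach-closed (_ , q∈ , _ , D∈ , refl , inj₂ (_ , Reach-∈ p , Reach-complete p ,
        proj₂ (Der-∈ e) , Der-complete e))

    Reach-sound : ∀ {X} → X ∈ᵗ (U ⊠ U) → X ∉ᵗ Rr → Reach X
    Reach-sound X∈ X∉ = reach-ind Reach
      (λ { R x∈ ih (r , r∈ , C , C∈ , refl , inj₁ eq) → subst Reach (sym eq) (start r∈ C∈ (sym eq))
         ; R x∈ ih (r , r∈ , C , C∈ , refl , inj₂ (y , y∈ , y∉ , t∈ , p)) →
             next (ih y∈ y∉) (Der-sound y∈ t∈ p) })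
      (X∈ , X∉)

-- Simulations between two canonical models

module Simulation (T₁ T₂ S U : Tree) (U-closed : Closed U) (S∈U : S ∈ᵗ U) where

  module C₁ = Completion T₁ U U-closed
  module C₂ = Completion T₂ U U-closed

  P : Tree
  P = U ⊠ U

  -- When an edge of the second model may answer one of the first: every conjunction of signature
  -- roles true along q is true along q′.
  Weaker : Tree → Tree → Set
  Weaker q q′ = ∀ {s} → tagged 1 (s ∷ []) ∈ᵗ S → C₁.Sub q s → C₂.Sub q′ s

  -- The complement of the greatest Σ-simulation between the two models.
  data NonSim : Tree → Tree → Set where
    name : ∀ {d e n} → d ∈ᵗ P → e ∈ᵗ P → atomᵗ n ∈ᵗ S →
           C₁.Der d (atomᵗ n) → ¬ C₂.Der e (atomᵗ n) → NonSim d e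
    -- L contains all admissible answers. Being a list, it allows the concepts that refute them to
    -- be combined into one conjunction; s makes the conjunction of roles nonempty.
    edge : ∀ {d e q D s} L → d ∈ᵗ P → e ∈ᵗ P → C₁.Edge d q D →
           tagged 1 (s ∷ []) ∈ᵗ S → C₁.Sub q s →
           (∀ {q′ D′} → C₂.Edge e q′ D′ → Weaker q q′ → (q′ ∙ D′) ∈ L) →
           (∀ {y} → y ∈ L → NonSim (q ∙ D) y) →
           NonSim d e

  R : Tree
  R = sem sims′ (C₁.Rs ∙ (C₁.Rd ∙ (C₂.Rs ∙ (C₂.Rd ∙ (S ∙ (U ∙ (P ∙ nil)))))))

  open Sims.Result (P ⊠ P) (C₁.Rs ∙ (C₁.Rd ∙ (C₂.Rs ∙ (C₂.Rd ∙ (S ∙ (U ∙ (P ∙ nil)))))))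
    using () renaming (closed to sims-closed; induction to sims-ind)

  NonSim-∈ : ∀ {d e} → NonSim d e → d ∈ᵗ P × e ∈ᵗ P
  NonSim-∈ (name d∈ e∈ _ _ _)   = d∈ , e∈
  NonSim-∈ (edge _ d∈ e∈ _ _ _ _ _) = d∈ , e∈

  private
    S⊆U : ∀ {σ} → σ ∈ᵗ S → σ ∈ᵗ U
    S⊆U = closed-elems U-closed S S∈U

    arg : ∀ {i x ts} → (numeral i ∙ (x ∙ ts)) ∈ᵗ U → x ∈ᵗ U
    arg t∈ = proj₁ (U-closed (proj₂ (U-closed t∈)))

    arg₂ : ∀ {i x y} → tagged i (x ∷ y ∷ []) ∈ᵗ U → y ∈ᵗ U
    arg₂ t∈ = proj₁ (U-closed (proj₂ (U-closed (proj₂ (U-closed t∈)))))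

    decide : ∀ {x t} → ¬ (x ∉ᵗ t) → x ∈ᵗ t
    decide {x} {t} = decidable-stable (x ∈? elems t)

  NonSim-complete : ∀ {d e} → NonSim d e → (d ∙ e) ∉ᵗ R
  NonSim-complete (name d∈ e∈ n∈ p ¬q) = sims-closed
    (_ , d∈ , _ , e∈ , refl , inj₁ (_ , arg {0} (S⊆U n∈) , n∈ , C₁.Der-complete p ,
      decide λ ∉R → ¬q (C₂.Der-sound e∈ (S⊆U n∈) ∉R)))
  NonSim-complete {d} {e} (edge L d∈ e∈ p s∈ qs covers f) with t∈ ← proj₂ (C₁.Der-∈ p) = sims-closed
    (_ , d∈ , _ , e∈ , refl , inj₂ (_ , arg {3} t∈ , _ , arg₂ {3} t∈ , t∈ , C₁.Der-complete p ,
      (_ , arg {1} (S⊆U s∈) , s∈ , C₁.Sub-complete qs) ,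
      λ { (q′ , q′∈ , D′ , D′∈ , t′∈ , p′ , sim , ¬bad) →
          NonSim-complete
            (f (covers (C₂.Der-sound e∈ t′∈ p′) λ {s} s∈ qs →
              C₂.Sub-sound q′∈ (arg {1} (S⊆U s∈)) λ bad →
                ¬bad (s , arg {1} (S⊆U s∈) , s∈ , C₁.Sub-complete qs , bad)))
            sim }))

  private
    NonSimᵗ : Tree → Set
    NonSimᵗ nil     = ⊥
    NonSimᵗ (d ∙ e) = NonSim d e

  NonSim-sound : ∀ {d e} → d ∈ᵗ P → e ∈ᵗ P → (d ∙ e) ∉ᵗ R → NonSim d e
  NonSim-sound d∈ e∈ de∉ = sims-ind NonSimᵗ
    (λ { R x∈ ih (d , d∈ , e , e∈ , refl , inj₁ (n , n∈U , n∈ , p , q)) →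
         name d∈ e∈ n∈ (C₁.Der-sound d∈ (S⊆U n∈) p) (λ q′ → C₂.Der-complete q′ q)
       ; R x∈ ih (d , d∈ , e , e∈ , refl ,
           inj₂ (q , q∈ , D , D∈ , t∈ , p , (s , s∈U , s∈ , qs) , ¬sim)) →
         let dissimilar? = λ y → ¬? (((q ∙ D) ∙ y) ∈? elems R)
             qD∈ = ∈-⊠⁺ U U q∈ D∈
             -- All candidates already separated from `q ∙ D`, whether or not they are successors of
             -- e; that the admissible successors are among them is what `¬sim` says.
             successors = filter dissimilar? (elems P) in
         edge successors d∈ e∈ (C₁.Der-sound d∈ t∈ p) s∈ (C₁.Sub-sound q∈ s∈U qs)
           (λ {q′} {D′} p′ w →
             let t′∈ = proj₂ (C₂.Der-∈ p′)
                 q′∈ = arg {3} t′∈ ; D′∈ = arg₂ {3} t′∈ in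
             ∈-filter⁺ dissimilar? (∈-⊠⁺ U U q′∈ D′∈) λ sim →
               ¬sim (q′ , q′∈ , D′ , D′∈ , t′∈ , C₂.Der-complete p′ , sim ,
                 λ { (s , s∈U , s∈ , qs , bad) →
                     C₂.Sub-complete (w s∈ (C₁.Sub-sound q∈ s∈U qs)) bad }))
           (λ y∈ → let y∈P , y∉ = ∈-filter⁻ dissimilar? {xs = elems P} y∈ in
             ih (∈-⊠⁺ P P qD∈ y∈P) y∉) })
    (∈-⊠⁺ P P d∈ e∈ , de∉)

  NonSim? : ∀ d e → Dec (NonSim d e)
  NonSim? d e with d ∈? elems P | e ∈? elems P | (d ∙ e) ∈? elems R
  ... | no  d∉ | _      | _       = no λ p → d∉ (proj₁ (NonSim-∈ p))
  ... | yes _  | no  e∉ | _       = no λ p → e∉ (proj₂ (NonSim-∈ p))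
  ... | yes _  | yes _  | yes de∈ = no λ p → NonSim-complete p de∈
  ... | yes d∈ | yes e∈ | no  de∉ = yes (NonSim-sound d∈ e∈ de∉)

  -- The elements root and b interpret the two individual names.
  module Test (root b : Tree) where

    -- The case `global` is what the universal role can detect: an element of the first model that
    -- no element of the second simulates.
    data Different : Set where
      at-root : NonSim root root → Different
      at-b    : NonSim b b → Different
      global  : ∀ {d} → C₁.Reach root d → (∀ {e} → C₂.Reach root e → NonSim d e) → Different

    Outcome : Set
    Outcome = (root ∙ root) ∉ᵗ R ⊎ (b ∙ b) ∉ᵗ R ⊎
      Σ[ d ∈ Tree ] (d ∈ᵗ P × d ∉ᵗ C₁.Rr root ×
        ¬ (Σ[ e ∈ Tree ] (e ∈ᵗ P × e ∉ᵗ C₂.Rr root × (d ∙ e) ∈ᵗ R)))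

    outcome-sound : root ∈ᵗ P → b ∈ᵗ P → Outcome → Different
    outcome-sound r∈ b∈ (inj₁ p)        = at-root (NonSim-sound r∈ r∈ p)
    outcome-sound r∈ b∈ (inj₂ (inj₁ p)) = at-b (NonSim-sound b∈ b∈ p)
    outcome-sound r∈ b∈ (inj₂ (inj₂ (d , d∈ , d∉ , ¬sim))) =
      global (C₁.Reach-sound root d∈ d∉) λ {e} p →
        let e∈ = C₂.Reach-∈ root p in
        NonSim-sound d∈ e∈ λ sim → ¬sim (e , e∈ , C₂.Reach-complete root p , sim)

    outcome-complete : Different → Outcome
    outcome-complete (at-root p)  = inj₁ (NonSim-complete p)
    outcome-complete (at-b p)     = inj₂ (inj₁ (NonSim-complete p))
    outcome-complete (global p f) = inj₂ (inj₂ (_ , C₁.Reach-∈ root p , C₁.Reach-complete root p ,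
      λ { (e , e∈ , e∉ , sim) → NonSim-complete (f (C₂.Reach-sound root e∈ e∉)) sim }))

-- Canonical models

∈-encList⁺ : ∀ {A : Set} (enc : A → Tree) {x xs} → x ∈ xs → enc x ∈ᵗ encList enc xs
∈-encList⁺ enc {xs = xs} x∈ = subst (_ ∈_) (sym (elems-encList enc xs)) (∈-map⁺ enc x∈)

∈-encList⁻ : ∀ {A : Set} (enc : A → Tree) (dec : Tree → A) → (∀ x → dec (enc x) ≡ x) →
             ∀ {t xs} → t ∈ᵗ encList enc xs → dec t ∈ xs × enc (dec t) ≡ t
∈-encList⁻ enc dec dec-enc {xs = xs} t∈
  with x , x∈ , refl ← ∈-map⁻ enc (subst (_ ∈_) (elems-encList enc xs) t∈) =
  subst (_∈ xs) (sym (dec-enc x)) x∈ , cong enc (dec-enc x)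

module Canonical (T : TBox) (U : Tree) (U-closed : Closed U)
                 (T∈U : encList encInclusion T ∈ᵗ U) (C₀ : EL)
                 (root-∈ : ρ₀ ∈ᵗ U × encEL C₀ ∈ᵗ U) where

  open Completion (encList encInclusion T) U U-closed public

  root : Tree
  root = ρ₀ ∙ encEL C₀

  -- Unreachable pairs are left out because the universal role ranges over the whole domain, and
  -- other models need not realise them.
  Element : Set
  Element = Σ[ d ∈ Tree ] Reach root d

  root-reach : Reach root root
  root-reach = start (proj₁ root-∈) (proj₂ root-∈) refl

  Link : N_R → Tree → Tree → Set
  Link s d nil     = ⊥
  Link s d (q ∙ D) = Edge d q D × Sub q (encName s)

  model : (N_I → Element) → Interpretation
  model ι = record
    { Δ     = Element
    ; cname = λ A (d , _) → Der d (encEL (atom A))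
    ; rname = λ s (d , _) (e , _) → Link s d e
    ; iname = ι
    }

  private
    α∈U : ∀ {α} → α ∈ T → encInclusion α ∈ᵗ U
    α∈U α∈ = closed-elems U-closed _ T∈U (∈-encList⁺ encInclusion α∈)

    arg₁ : ∀ {i t ts} → (numeral i ∙ (t ∙ ts)) ∈ᵗ U → t ∈ᵗ U
    arg₁ = proj₁ ∘ U-closed ∘ proj₂ ∘ U-closed

    arg₂ : ∀ {i t u ts} → (numeral i ∙ (t ∙ (u ∙ ts))) ∈ᵗ U → u ∈ᵗ U
    arg₂ = proj₁ ∘ U-closed ∘ proj₂ ∘ U-closed ∘ proj₂ ∘ U-closed

    inside : ∀ {d} → Reach root d → Σ[ r ∈ Tree ] Σ[ C ∈ Tree ] (d ≡ r ∙ C × r ∈ᵗ U × C ∈ᵗ U)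
    inside (start r∈ C∈ eq) = _ , _ , eq , r∈ , C∈
    inside (next p e) with t∈ ← proj₂ (Der-∈ e) = _ , _ , refl , arg₁ {3} t∈ , arg₂ {3} t∈

  module _ (ι : N_I → Element) where

    private M = model ι

    Der⇒⟦⟧ : ∀ C {d} (p : Reach root d) → Der d (encEL C) → ⟦ M ⟧ C (d , p)
    Der⇒⟦⟧ (atom A) p x = x
    Der⇒⟦⟧ ⊤ᶜ       p x = _
    Der⇒⟦⟧ (C ⊓ D)  p x = Der⇒⟦⟧ C p (⊓-elimˡ x) , Der⇒⟦⟧ D p (⊓-elimʳ x)
    Der⇒⟦⟧ (∃ᶜ r C) p x with t∈ ← proj₂ (Der-∈ x) =
      (encName r ∙ encEL C , next p x) , (x , refl (arg₁ {3} t∈) (ρ₀≢encName r)) ,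
      Der⇒⟦⟧ C _ (init (arg₁ {3} t∈) (arg₂ {3} t∈))

    -- Limited to `U`, outside which nothing is derived. This suffices to verify axioms, where it
    -- turns truth of the premise, a concept in `U`, into a derivation.
    ⟦⟧⇒Der : ∀ C → encEL C ∈ᵗ U → ∀ {d} (p : Reach root d) → ⟦ M ⟧ C (d , p) → Der d (encEL C)
    ⟦⟧⇒Der (atom A) C∈ p x = x
    ⟦⟧⇒Der ⊤ᶜ       C∈ p x with _ , _ , refl , r∈ , D∈ ← inside p = top r∈ D∈ C∈
    ⟦⟧⇒Der (C ⊓ D)  C∈ p (x , y) =
      ⊓-intro C∈ (⟦⟧⇒Der C (arg₁ {2} C∈) p x) (⟦⟧⇒Der D (arg₂ {2} C∈) p y)
    ⟦⟧⇒Der (∃ᶜ r C) C∈ p ((nil , _) , () , _)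
    ⟦⟧⇒Der (∃ᶜ r C) C∈ p ((q ∙ D , p′) , (e , s) , x) =
      ∃-intro C∈ e s (⟦⟧⇒Der C (arg₂ {3} C∈) p′ x)

    satisfies : ∀ {α} → α ∈ T → SatInclusion M α
    satisfies {con C ⊑ D} α∈ {_ , p} x with C⊑D∈ ← α∈U α∈ =
      Der⇒⟦⟧ D p (axiom-con (arg₂ {0} C⊑D∈) (∈-encList⁺ encInclusion α∈)
        (⟦⟧⇒Der C (arg₁ {0} (arg₁ {0} C⊑D∈)) p x))
    satisfies {ran r ⊑ D} α∈ {nil , _} (_ , ())
    satisfies {ran r ⊑ D} α∈ {q ∙ C , p} (_ , e , s) =
      Der⇒⟦⟧ D p (axiom-ran (arg₂ {0} (α∈U α∈)) (arg₂ {3} (proj₂ (Der-∈ e)))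
        (∈-encList⁺ encInclusion α∈) s)
    satisfies {ran r ⊓ᴸ C ⊑ D} α∈ {nil , _} ((_ , ()) , _)
    satisfies {ran r ⊓ᴸ C ⊑ D} α∈ {q ∙ _ , p} ((_ , e , s) , x) with C⊑D∈ ← α∈U α∈ =
      Der⇒⟦⟧ D p (axiom-ran⊓ (arg₂ {0} C⊑D∈) (∈-encList⁺ encInclusion α∈) s
        (⟦⟧⇒Der C (arg₂ {2} (arg₁ {0} C⊑D∈)) p x))
    satisfies {C ≣ D} α∈ with C≣D∈ ← α∈U α∈ =
      (λ {(_ , p)} x → Der⇒⟦⟧ D p (axiom-≣ˡ (arg₂ {1} C≣D∈) (∈-encList⁺ encInclusion α∈)
        (⟦⟧⇒Der C (arg₁ {1} C≣D∈) p x))) ,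
      (λ {(_ , p)} x → Der⇒⟦⟧ C p (axiom-≣ʳ (arg₁ {1} C≣D∈) (∈-encList⁺ encInclusion α∈)
        (⟦⟧⇒Der D (arg₂ {1} C≣D∈) p x)))
    satisfies {r ⊑ᴿ s} α∈ {_} {nil , _} ()
    satisfies {r ⊑ᴿ s} α∈ {_} {_ ∙ _ , _} (e , x) =
      e , step (arg₂ {2} (α∈U α∈)) x (∈-encList⁺ encInclusion α∈)

    isModel : SatTBox M T
    isModel = All.tabulate λ α∈ → satisfies α∈

  module _ (I : Interpretation) (I⊨T : SatTBox I T) where
    open Interpretation I

    Realises : Tree → Δ → Set
    Realises nil     d = ⊥
    Realises (r ∙ C) d = (r ≢ ρ₀ → range I (decName r) d) × ⟦ I ⟧ (decEL C) d

    private
      axiom : ∀ {t} → t ∈ᵗ encList encInclusion T → SatInclusion I (decInclusion t)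
      axiom t∈ = All.lookup I⊨T (proj₁ (∈-encList⁻ encInclusion decInclusion decInclusion-enc t∈))

    Sub-holds : ∀ {r s} → Sub r s →
                r ≢ ρ₀ × (∀ {d e} → rname (decName r) d e → rname (decName s) d e)
    Sub-holds (refl _ r≢)   = r≢ , id
    Sub-holds (step _ p α∈) with r≢ , f ← Sub-holds p = r≢ , λ x → axiom α∈ (f x)

    Sub-range : ∀ {r s C d} → Sub r s → Realises (r ∙ C) d → range I (decName s) d
    Sub-range s (in-range , _) with r≢ , f ← Sub-holds s with e , x ← in-range r≢ = e , f x

    Der-holds : ∀ {X D d} → Der X D → Realises X d → ⟦ I ⟧ (decEL D) d
    Der-holds (init _ _)            re = proj₂ re
    Der-holds (top _ _ _)           re = _
    Der-holds (⊓-elimˡ p)           re = proj₁ (Der-holds p re)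
    Der-holds (⊓-elimʳ p)           re = proj₂ (Der-holds p re)
    Der-holds (⊓-intro _ p q)       re = Der-holds p re , Der-holds q re
    -- The witness e is a q-successor in the concept C, so it realises `q ∙ C` and the derivation at
    -- that element applies to it.
    Der-holds (∃-intro _ p s q)     re with e , x , y ← Der-holds p re =
      e , proj₂ (Sub-holds s) x , Der-holds q ((λ _ → _ , x) , y)
    Der-holds (axiom-con _ α∈ p)    re = axiom α∈ (Der-holds p re)
    Der-holds (axiom-≣ˡ _ α∈ p)     re = proj₁ (axiom α∈) (Der-holds p re)
    Der-holds (axiom-≣ʳ _ α∈ p)     re = proj₂ (axiom α∈) (Der-holds p re)
    Der-holds (axiom-ran {C = C} _ _ α∈ s)  re = axiom α∈ (Sub-range {C = C} s re)
    Der-holds (axiom-ran⊓ {C = C} _ α∈ s p) re =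
      axiom α∈ (Sub-range {C = C} s re , Der-holds p re)

    module _ {d₀ : Δ} (re₀ : Realises root d₀) where

      Reach-realised : ∀ {X} → Reach root X → ∃ (Realises X)
      Reach-realised (start _ _ refl) = d₀ , re₀
      Reach-realised (next p e) with d , re ← Reach-realised p
        with e′ , x , y ← Der-holds e re = e′ , (λ _ → d , x) , y

      -- `Realises` is a simulation of the canonical model by I, and total on reachable elements,
      -- which takes care of the universal role.
      transfer : ∀ ι C {X} (p : Reach root X) {d} →
                 ⟦ model ι ⟧ᵘ C (X , p) → Realises X d → ⟦ I ⟧ᵘ C d
      transfer ι (atom A) p x re = subst (λ B → cname B _) (decName-enc A) (Der-holds x re)
      transfer ι ⊤ᶜ       p x re = _
      transfer ι (C ⊓ D)  p (x , y) re = transfer ι C p x re , transfer ι D p y re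
      transfer ι (∃ᶜ (r ∷⁺ R) C) p ((nil , _) , () ∷ _ , _) re
      -- All roles of the conjunction lie above the same q, so a single q-successor in I serves for
      -- all of them.
      transfer ι (∃ᶜ (r ∷⁺ R) C) p ((q ∙ D , p′) , links , x) re
        with e , l , y ← Der-holds (proj₁ (All.head links)) re =
        e , All.map (λ {s} (_ , qs) → subst (λ s → rname s _ e) (decName-enc s) (proj₂ (Sub-holds qs) l)) links ,
        transfer ι C p′ x ((λ _ → _ , l) , y)
      transfer ι (∃u C) p ((_ , p′) , x) re with e , re′ ← Reach-realised p′ =
        e , transfer ι C p′ x re′

-- Concepts over a signature and the symbols of their queries

module _ (S : List Symbol) where

  Over : C⊓u → Set
  Over (atom A) = inj₁ A ∈ S
  Over ⊤ᶜ       = ⊤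
  Over (C ⊓ D)  = Over C × Over D
  Over (∃ᶜ R C) = All (λ r → inj₂ r ∈ S) (toList R) × Over C
  Over (∃u C)   = Over C

  private
    symbols : ∀ {n m} → List (Atom n m) → List Symbol
    symbols = concatMap symbolsQ

    roleAtoms : ∀ {m} (t u : Term 0 m) → List N_R → List (Atom 0 m)
    roleAtoms t u = map (λ r → r ⟨ t ⨾ u ⟩)

    role-symbols⁺ : ∀ {m} (t u : Term 0 m) {R} → All (λ r → inj₂ r ∈ S) R →
                    All (_∈ S) (symbols (roleAtoms t u R))
    role-symbols⁺ t u []       = []
    role-symbols⁺ t u (r∈ ∷ p) = r∈ ∷ role-symbols⁺ t u p

    role-symbols⁻ : ∀ {m} (t u : Term 0 m) R →
                    All (_∈ S) (symbols (roleAtoms t u R)) → All (λ r → inj₂ r ∈ S) R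
    role-symbols⁻ t u []      p        = []
    role-symbols⁻ t u (r ∷ R) (r∈ ∷ p) = r∈ ∷ role-symbols⁻ t u R p

    split : ∀ {n m} (φ ψ : List (Atom n m)) → All (_∈ S) (symbols (φ ++ ψ)) →
            All (_∈ S) (symbols φ) × All (_∈ S) (symbols ψ)
    split φ ψ p = All.++⁻ (symbols φ) (subst (All _) (concatMap-++ symbolsQ φ ψ) p)

    join : ∀ {n m} (φ ψ : List (Atom n m)) → All (_∈ S) (symbols φ) → All (_∈ S) (symbols ψ) →
           All (_∈ S) (symbols (φ ++ ψ))
    join φ ψ p q = subst (All _) (sym (concatMap-++ symbolsQ φ ψ)) (All.++⁺ p q)

  Over⇒symbols : ∀ {m} C (t : Term 0 m) ρ → Over C → All (_∈ S) (symbols (unravel C t ρ))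
  Over⇒symbols (atom A) t ρ A∈       = A∈ ∷ []
  Over⇒symbols ⊤ᶜ       t ρ _        = []
  Over⇒symbols (C ⊓ D)  t ρ (p , q)  = join (unravel C t _) (unravel D t _)
    (Over⇒symbols C t _ p) (Over⇒symbols D t _ q)
  Over⇒symbols (∃ᶜ R C) t ρ (p , q)  = let u = var (ρ zero) in
    join (roleAtoms t u (toList R)) (unravel C u (ρ ∘ suc))
      (role-symbols⁺ t u p) (Over⇒symbols C u _ q)
  Over⇒symbols (∃u C)   t ρ p        = Over⇒symbols C _ _ p

  symbols⇒Over : ∀ {m} C (t : Term 0 m) ρ → All (_∈ S) (symbols (unravel C t ρ)) → Over C
  symbols⇒Over (atom A) t ρ (A∈ ∷ []) = A∈
  symbols⇒Over ⊤ᶜ       t ρ _         = tt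
  symbols⇒Over (C ⊓ D)  t ρ p with p₁ , p₂ ← split (unravel C t _) (unravel D t _) p =
    symbols⇒Over C t _ p₁ , symbols⇒Over D t _ p₂
  symbols⇒Over (∃ᶜ R C) t ρ p
    with p₁ , p₂ ← split (roleAtoms t (var (ρ zero)) (toList R)) (unravel C _ (ρ ∘ suc)) p =
    role-symbols⁻ t (var (ρ zero)) (toList R) p₁ , symbols⇒Over C _ _ p₂
  symbols⇒Over (∃u C)   t ρ p = symbols⇒Over C _ _ p

-- Distinguishing concepts and preservation under simulation

module Comparison (T₁ T₂ : TBox) (S : List Symbol) (U : Tree) (U-closed : Closed U)
                  (T₁∈U : encList encInclusion T₁ ∈ᵗ U) (T₂∈U : encList encInclusion T₂ ∈ᵗ U)
                  (S∈U : encSymbols S ∈ᵗ U) (C₀ : EL) (root-∈ : ρ₀ ∈ᵗ U × encEL C₀ ∈ᵗ U) where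

  module M₁ = Canonical T₁ U U-closed T₁∈U C₀ root-∈
  module M₂ = Canonical T₂ U U-closed T₂∈U C₀ root-∈
  open Simulation (encList encInclusion T₁) (encList encInclusion T₂) (encSymbols S) U U-closed S∈U public

  root : Tree
  root = ρ₀ ∙ encEL C₀

  module _ (ι₁ : N_I → M₁.Element) (ι₂ : N_I → M₂.Element) where

    private
      ⟦_⟧₁ : C⊓u → M₁.Element → Set
      ⟦_⟧₁ = ⟦ M₁.model ι₁ ⟧ᵘ

      ⟦_⟧₂ : C⊓u → M₂.Element → Set
      ⟦_⟧₂ = ⟦ M₂.model ι₂ ⟧ᵘ

      decode : ∀ {t} → t ∈ᵗ encSymbols S → decSymbol t ∈ S × encSymbol (decSymbol t) ≡ t
      decode = ∈-encList⁻ encSymbol decSymbol decSymbol-enc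

      role-code : ∀ {s} → tagged 1 (s ∷ []) ∈ᵗ encSymbols S → encName {role} (decName s) ≡ s
      role-code s∈ = cong (hd ∘ tl) (proj₂ (decode s∈))

      -- These role names describe an edge q as precisely as the signature permits; their
      -- conjunction is the role of the distinguishing concept.
      roles-above : ∀ q → q ∈ᵗ U → (L : List Symbol) → (∀ {r} → inj₂ r ∈ L → inj₂ r ∈ S) → Σ[ R ∈ List N_R ]
        (All (λ r → inj₂ r ∈ S × C₁.Sub q (encName r)) R ×
         (∀ {r} → inj₂ r ∈ L → C₁.Sub q (encName r) → r ∈ R))
      roles-above q q∈ []           L⊆S = [] , [] , λ ()
      roles-above q q∈ (inj₁ A ∷ L) L⊆S with R , all , complete ← roles-above q q∈ L (L⊆S ∘ there) =
        R , all , λ { (there r∈) → complete r∈ }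
      roles-above q q∈ (inj₂ r ∷ L) L⊆S
        with R , all , complete ← roles-above q q∈ L (L⊆S ∘ there)
           | r∈ ← L⊆S (here refl)
        with C₁.Sub? q∈ (proj₁ (U-closed (proj₂ (U-closed
               (closed-elems U-closed (encSymbols S) S∈U (∈-encList⁺ encSymbol r∈))))))
      ... | yes p = r ∷ R , (r∈ , p) ∷ all ,
        λ { (here refl) _ → here refl ; (there r∈) qs → there (complete r∈ qs) }
      ... | no ¬p = R , all ,
        λ { (here refl) qs → contradiction qs ¬p ; (there r∈) qs → complete r∈ qs }

    -- Reachability proofs are quantified over because `NonSim` also relates pairs in P that are not
    -- elements of the models.
    Distinguished : Tree → Tree → Set
    Distinguished d e = Σ[ C ∈ C⊓u ] (Over S C × (∀ p → ⟦ C ⟧₁ (d , p)) × (∀ p → ¬ ⟦ C ⟧₂ (e , p)))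

    conjunction : ∀ {d} L → (∀ {e} → e ∈ L → Distinguished d e) → Σ[ C ∈ C⊓u ]
      (Over S C × (∀ p → ⟦ C ⟧₁ (d , p)) × (∀ {e} → e ∈ L → ∀ p → ¬ ⟦ C ⟧₂ (e , p)))
    conjunction []      f = ⊤ᶜ , tt , _ , λ ()
    conjunction (y ∷ L) f
      with C , oC , C₁ , ¬C₂ ← f (here refl)
         | D , oD , D₁ , ¬D₂ ← conjunction L (f ∘ there) =
      C ⊓ D , (oC , oD) , (λ p → C₁ p , D₁ p) ,
      λ { (here refl) p (x , _) → ¬C₂ p x ; (there e∈) p (_ , x) → ¬D₂ e∈ p x }

    -- For an edge, take the existential over all signature roles above q of the conjunction of the
    -- concepts for L. Any such successor of e is reached by an admissible answer, hence lies in L,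
    -- where the conjunction fails.
    distinguish : ∀ {d e} → NonSim d e → Distinguished d e
    distinguish (name {n = n} d∈ e∈ n∈ p ¬q) with A∈ , eq ← decode n∈ =
      atom (decName n) , A∈ , (λ _ → subst (C₁.Der _) (sym eq) p) ,
      λ _ q → ¬q (subst (C₂.Der _) eq q)
    distinguish (edge {q = q} {D} {s} L d∈ e∈ p s∈ qs covers f)
      with r∈ , _ ← decode s∈
         | C , oC , C₁ , ¬C₂ ← conjunction L (λ y∈ → distinguish (f y∈))
         | R , all , complete ← roles-above q (proj₁ (C₁.Sub-∈ qs)) S id =
      ∃ᶜ R⁺ C , (All.map proj₁ all⁺ , oC) ,
      (λ pd → (q ∙ D , C₁.next pd p) , All.map (λ (_ , qs) → p , qs) all⁺ , C₁ _) ,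
      λ { pe ((nil , _) , () ∷ _ , _)
        ; pe ((q′ ∙ D′ , pe′) , links , x) →
            ¬C₂ (covers (proj₁ (All.head links)) (λ s∈ qs →
                   let r∈ , _ = decode s∈ ; eq = role-code s∈ in
                   subst (C₂.Sub q′) eq (proj₂ (All.lookup links
                     (there (complete r∈ (subst (C₁.Sub q) (sym eq) qs)))))))
                pe′ x }
      where
      r = decName s
      -- Repeating r in front exhibits the conjunction as nonempty.
      R⁺ = r ∷⁺ R
      all⁺ = (r∈ , subst (C₁.Sub q) (sym (role-code s∈)) qs) ∷ all

    -- A matching successor is not computed. If none satisfied C, every admissible answer would be
    -- dissimilar to the given successor, and the list of all dissimilar elements would yield an
    -- `edge` against similarity of d and e. This refutation is why the conclusion is doubly
    -- negated.
    preserve : ∀ b → ¬ Test.Different root b → ∀ C → Over S C →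
      ∀ {d e} (p : C₁.Reach root d) (p′ : C₂.Reach root e) →
      ⟦ C ⟧₁ (d , p) → ¬ NonSim d e → ¬ ¬ ⟦ C ⟧₂ (e , p′)
    preserve b same (atom A) A∈ p p′ x sim ¬y = sim (name (C₁.Reach-∈ root p) (C₂.Reach-∈ root p′)
      (∈-encList⁺ encSymbol A∈) x ¬y)
    preserve b same ⊤ᶜ o p p′ x sim ¬y = ¬y _
    preserve b same (C ⊓ D) (oC , oD) p p′ (x , y) sim ¬xy =
      preserve b same C oC p p′ x sim λ x′ →
      preserve b same D oD p p′ y sim λ y′ → ¬xy (x′ , y′)
    preserve b same (∃ᶜ R C) o p p′ ((nil , _) , () ∷ _ , _) sim ¬y
    preserve b same (∃ᶜ R C) (oR , oC) p p′ ((q ∙ D , pq) , links , x) sim ¬y =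
      sim (edge (filter nonsim? (elems P)) (C₁.Reach-∈ root p) (C₂.Reach-∈ root p′)
        (proj₁ (All.head links)) (∈-encList⁺ encSymbol (All.head oR)) (proj₂ (All.head links))
        (λ {q′} {D′} e′ weaker →
          let pe = C₂.next p′ e′ in
          ∈-filter⁺ nonsim? (C₂.Reach-∈ root pe) (decidable-stable (nonsim? _) λ sim′ →
            preserve b same C oC pq pe x sim′ λ x′ →
              ¬y ((q′ ∙ D′ , pe) , All.map (λ ((_ , qs) , r∈) → e′ , weaker (∈-encList⁺ encSymbol r∈) qs)
                    (All.zip (links , oR)) , x′)))
        (λ y∈ → proj₂ (∈-filter⁻ nonsim? {xs = elems P} y∈)))
      where
      nonsim? = NonSim? (q ∙ D)
    preserve b same (∃u C) o p p′ ((d , pd) , x) sim ¬y =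
      same (Test.global pd λ {e} pe → decidable-stable (NonSim? d e)
        λ sim′ → preserve b same C o pd pe x sim′ λ x′ → ¬y ((e , pe) , x′))

-- The algorithm

-- In the environment X ∙ (T₁ ∙ (T₂ ∙ S)), with X the symbol to be tested.
argument′ C₀′ b′ root′ setup′ sims-setup′ ders-setup′ subs-setup′ : Fn
argument′ = head′ ∘′ tail′ ∘′ v 0
-- The tag is nil exactly for concept names, and the code of a concept name as a symbol is also its
-- code as an atomic concept.
C₀′   = if′ (head′ ∘′ v 0) (∃ᶜ′ argument′ (const′ ⊤ᵗ)) (v 0)
b′    = if′ (head′ ∘′ v 0) (argument′ ∙′ const′ ⊤ᵗ) (const′ ρ₀ ∙′ C₀′)
root′ = const′ ρ₀ ∙′ C₀′

setup′ = root′ ∙′ b′ ∙′ v 1 ∙′ v 2 ∙′ (tail′ ∘′ tail′ ∘′ tail′) ∙′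
         (subtrees′ ∘′ (root′ ∙′ tail′)) ∙′ nil′

-- Variables: root b T₁ T₂ S U.
subs-setup′ = (subs′ ∘′ (v 2 ∙′ v 5 ∙′ nil′)) ∙′ (subs′ ∘′ (v 3 ∙′ v 5 ∙′ nil′)) ∙′ square′ (v 5) ∙′ id′

-- Variables: Rs₁ Rs₂ P root b T₁ T₂ S U.
ders-setup′ = (ders′ ∘′ (v 0 ∙′ v 5 ∙′ v 8 ∙′ nil′)) ∙′ (ders′ ∘′ (v 1 ∙′ v 6 ∙′ v 8 ∙′ nil′)) ∙′ id′

-- Variables: Rd₁ Rd₂ Rs₁ Rs₂ P root b T₁ T₂ S U.
sims-setup′ =
  (sims′ ∘′ (v 2 ∙′ v 0 ∙′ v 3 ∙′ v 1 ∙′ v 9 ∙′ v 10 ∙′ v 4 ∙′ nil′)) ∙′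
  (reach′ ∘′ (v 0 ∙′ v 5 ∙′ v 10 ∙′ v 4 ∙′ nil′)) ∙′
  (reach′ ∘′ (v 1 ∙′ v 5 ∙′ v 10 ∙′ v 4 ∙′ nil′)) ∙′ id′

-- Variables: R Rr₁ Rr₂ Rd₁ Rd₂ Rs₁ Rs₂ P root b.
outcome′ : Formula
outcome′ = v 8 ∙′ v 8 ∉′ v 0 ∨′ v 9 ∙′ v 9 ∉′ v 0 ∨′
  ∃′ (v 7) (v 0 ∉′ v 2 ∧′ ¬′ ∃′ (v 8) (v 0 ∉′ v 4 ∧′ v 1 ∙′ v 0 ∈′ v 2))

-- The concept whose canonical model is also that of the ABox: for r(a,b), the root is a and its
-- successor in `⊤ᶜ` is b.
rootConcept : Symbol → EL
rootConcept (inj₁ A) = atom A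
rootConcept (inj₂ r) = ∃ᶜ r ⊤ᶜ

-- For a concept name, b does not occur in the ABox; placing it at the root makes the condition at b
-- repeat that at a.
b-tree : Symbol → Tree
b-tree (inj₁ A) = ρ₀ ∙ encEL (atom A)
b-tree (inj₂ r) = encName r ∙ ⊤ᵗ

environment : (root b T₁ T₂ S U : Tree) → Tree
environment root b T₁ T₂ S U = root ∙ (b ∙ (T₁ ∙ (T₂ ∙ (S ∙ (U ∙ nil)))))

-- Opaque, since comparing types would otherwise evaluate the fixpoints.
opaque
  decide′ : Formula
  decide′ = outcome′ [ sims-setup′ ∘′ ders-setup′ ∘′ subs-setup′ ]′

  outcome-meaning : ∀ T₁ T₂ S U (U-closed : Closed U) (S∈U : S ∈ᵗ U) root b →
    Meaning decide′ (environment root b T₁ T₂ S U) ≡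
    Simulation.Test.Outcome T₁ T₂ S U U-closed S∈U root b
  outcome-meaning T₁ T₂ S U U-closed S∈U root b = refl

_≟ᴵ_ : (a b : N_I) → Dec (a ≡ b)
name v ≟ᴵ name w = Dec.map′ (cong name) (cong Name.word) (≡-dec Bool._≟_ v w)

-- Correctness of the test for a single symbol

module Correctness (a b : N_I) (a≢b : a ≢ b) where

  abox : Symbol → ABox
  abox (inj₁ A) = [ A ⟨ a ⟩ ]⁺
  abox (inj₂ r) = [ r ⟨ a ⨾ b ⟩ ]⁺

  rootTree : Symbol → Tree
  rootTree X = ρ₀ ∙ encEL (rootConcept X)

  data Point : Symbol → N_I → Tree → Set where
    at-a : ∀ {X} → Point X a (rootTree X)
    at-b : ∀ {r} → Point (inj₂ r) b (b-tree (inj₂ r))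

  module Entailment (T : TBox) (U : Tree) (U-closed : Closed U)
                    (T∈U : encList encInclusion T ∈ᵗ U) (X : Symbol)
                    (root-∈ : ρ₀ ∈ᵗ U × encEL (rootConcept X) ∈ᵗ U) where

    open Canonical T U U-closed T∈U (rootConcept X) root-∈ public

    b-reach : ∀ X (root-∈ : ρ₀ ∈ᵗ U × encEL (rootConcept X) ∈ᵗ U) → Reach (rootTree X) (b-tree X)
    b-reach (inj₁ A) (ρ₀∈ , C∈) = start ρ₀∈ C∈ refl
    b-reach (inj₂ r) (ρ₀∈ , C∈) = next (start ρ₀∈ C∈ refl) (init ρ₀∈ C∈)

    ι : N_I → Element
    ι n with n ≟ᴵ b
    ... | yes _ = b-tree X , b-reach X root-∈
    ... | no  _ = root , root-reach

    ι-a : ι a ≡ (root , root-reach)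
    ι-a with a ≟ᴵ b
    ... | yes a≡b = contradiction a≡b a≢b
    ... | no  _   = refl

    ι-b : ι b ≡ (b-tree X , b-reach X root-∈)
    ι-b with b ≟ᴵ b
    ... | yes _   = refl
    ... | no  b≢b = contradiction refl b≢b

    element : ∀ {c t} → Point X c t → Σ[ p ∈ Reach root t ] ι c ≡ (t , p)
    element at-a = _ , ι-a
    element at-b = _ , ι-b

    model-abox : ∀ Y → Y ≡ X → SatABox (model ι) (abox Y)
    model-abox (inj₁ A) refl =
      subst (λ e → Der (proj₁ e) (encEL (atom A))) (sym ι-a)
        (init (proj₁ root-∈) (proj₂ root-∈)) ∷ []
    model-abox (inj₂ r) refl =
      subst₂ (λ d e → Link r (proj₁ d) (proj₁ e)) (sym ι-a) (sym ι-b)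
        (init (proj₁ root-∈) (proj₂ root-∈) ,
         refl (proj₁ (U-closed (proj₂ (U-closed (proj₂ root-∈))))) (ρ₀≢encName r)) ∷ []

    root-realised : ∀ I (I⊨T : SatTBox I T) Y → Y ≡ X → SatABox I (abox Y) →
                    Realises I I⊨T root (Interpretation.iname I a)
    root-realised I I⊨T (inj₁ A) refl (x ∷ []) =
      (λ ρ₀≢ → contradiction refl ρ₀≢) ,
      subst (λ B → Interpretation.cname I B _) (sym (decName-enc A)) x
    root-realised I I⊨T (inj₂ r) refl (x ∷ []) =
      (λ ρ₀≢ → contradiction refl ρ₀≢) ,
      _ , subst (λ s → Interpretation.rname I s _ _) (sym (decName-enc r)) x , _

    point-realised : ∀ I (I⊨T : SatTBox I T) {c t} → Point X c t → SatABox I (abox X) →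
                     Realises I I⊨T t (Interpretation.iname I c)
    point-realised I I⊨T at-a p = root-realised I I⊨T X refl p
    point-realised I I⊨T (at-b {r}) (x ∷ []) =
      (λ _ → _ , subst (λ s → Interpretation.rname I s _ _) (sym (decName-enc r)) x) , _

    holds⇒entails : ∀ {c t} C (pt : Point X c t) → ⟦ model ι ⟧ᵘ C (t , proj₁ (element pt)) →
                    Entails T (abox X) (assertionQuery C c) []
    holds⇒entails {c} C pt x I I⊨T I⊨A = Equivalence.from (assertionQuery-correct I C c)
      (transfer I I⊨T (root-realised I I⊨T X refl I⊨A) ι C _ x (point-realised I I⊨T pt I⊨A))

    entails⇒holds : ∀ {c t} C (pt : Point X c t) → Entails T (abox X) (assertionQuery C c) [] →
                    ⟦ model ι ⟧ᵘ C (t , proj₁ (element pt))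
    entails⇒holds {c} C pt ent = subst (⟦ model ι ⟧ᵘ C) (proj₂ (element pt))
      (Equivalence.to (assertionQuery-correct (model ι) C c)
        (ent (model ι) (isModel ι) (model-abox X refl)))

  module _ (T₁ T₂ : TBox) (S : List Symbol) (U : Tree) (U-closed : Closed U)
           (T₁∈U : encList encInclusion T₁ ∈ᵗ U) (T₂∈U : encList encInclusion T₂ ∈ᵗ U)
           (S∈U : encSymbols S ∈ᵗ U) (X : Symbol)
           (root-∈ : ρ₀ ∈ᵗ U × encEL (rootConcept X) ∈ᵗ U) where

    private
      module E₁ = Entailment T₁ U U-closed T₁∈U X root-∈
      module E₂ = Entailment T₂ U U-closed T₂∈U X root-∈
    open Comparison T₁ T₂ S U U-closed T₁∈U T₂∈U S∈U (rootConcept X) root-∈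
    open Test (rootTree X) (b-tree X)

    Witness : Set₁
    Witness = Σ[ C ∈ C⊓u ] Σ[ c ∈ N_I ] Σ[ t ∈ Tree ]
      (Point X c t × qDiff (_∈ S) T₁ T₂ (abox X) (assertionQuery C c) [])

    distinguished⇒witness : X ∈ S → ∀ {c t} → Point X c t →
                            Distinguished E₁.ι E₂.ι t t → Witness
    distinguished⇒witness X∈S {c} pt (C , o , C₁ , ¬C₂) = C , c , _ , pt , record
      { abox-over    = over X X∈S
      ; query-over   = Over⇒symbols S C (ind c) id o
      ; tuple-in     = Vec.[]
      ; entailed     = E₁.holds⇒entails C pt (C₁ _)
      ; not-entailed = λ ent → ¬C₂ _ (E₂.entails⇒holds C pt ent)
      }
      where
      over : ∀ X → X ∈ S → abox X IsABoxOver (_∈ S)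
      over (inj₁ A) A∈ = A∈ ∷ []
      over (inj₂ r) r∈ = r∈ ∷ []

    different⇒witness : X ∈ S → Different → Witness
    different⇒witness X∈S (at-root p) =
      distinguished⇒witness X∈S at-a (distinguish E₁.ι E₂.ι p)
    different⇒witness X∈S (at-b p)    = case-b X refl p
      where
      case-b : ∀ Y → Y ≡ X → NonSim (b-tree Y) (b-tree Y) → Witness
      case-b (inj₁ A) refl p = distinguished⇒witness X∈S at-a (distinguish E₁.ι E₂.ι p)
      case-b (inj₂ r) refl p = distinguished⇒witness X∈S at-b (distinguish E₁.ι E₂.ι p)
    -- The conjunction holds at d and fails at all elements that do not simulate d, thus at all
    -- reachable ones. Behind the universal role, it can be asserted of a.
    different⇒witness X∈S (global {d} p f)
      with C , o , C₁ , ¬C₂ ← conjunction E₁.ι E₂.ι (filter (NonSim? d) (elems P))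
             (λ e∈ → distinguish E₁.ι E₂.ι (proj₂ (∈-filter⁻ (NonSim? d) {xs = elems P} e∈))) =
      distinguished⇒witness X∈S at-a
        (∃u C , o , (λ _ → (d , p) , C₁ p) ,
         λ { _ ((e , q) , x) → ¬C₂ (∈-filter⁺ (NonSim? d) (C₂.Reach-∈ (rootTree X) q) (f q)) q x })

    witness⇒different : Witness → ¬ ¬ Different
    witness⇒different (C , c , t , pt , diff) same =
      preserve E₁.ι E₂.ι (b-tree X) same C
        (symbols⇒Over S C (ind c) id (qDiff.query-over diff))
        (proj₁ (E₁.element pt)) (proj₁ (E₂.element pt))
        (E₁.entails⇒holds C pt (qDiff.entailed diff)) (similar pt)
        λ x → qDiff.not-entailed diff (E₂.holds⇒entails C pt x)
      where
      similar : ∀ {c t} → Point X c t → ¬ NonSim t t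
      similar at-a p = same (at-root p)
      similar at-b p = same (at-b p)

    decide-correct : X ∈ S → Meaning decide′ (environment (rootTree X) (b-tree X)
      (encList encInclusion T₁) (encList encInclusion T₂) (encSymbols S) U) ⇔ Witness
    decide-correct X∈S = mk⇔
      (λ m → different⇒witness X∈S (outcome-sound (∈-⊠⁺ U U (proj₁ root-∈) (proj₂ root-∈))
                (E₁.Reach-∈ (rootTree X) (E₁.b-reach X root-∈)) (subst id meaning m)))
      -- Decidability of the test removes the double negation inherited from `preserve`.
      (λ w → decidable-stable (Meaning? decide′ ρ) λ ¬m →
        witness⇒different w λ diff → ¬m (subst id (sym meaning) (outcome-complete diff)))
      where
      ρ = environment (rootTree X) (b-tree X) (encList encInclusion T₁)
                      (encList encInclusion T₂) (encSymbols S) U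
      meaning : Meaning decide′ ρ ≡ Outcome
      meaning = outcome-meaning _ _ _ U U-closed S∈U _ _

    witness⇔qWtn : X ∈ S → Witness ⇔ qWtnˡʰˢ a b (_∈ S) T₁ T₂ X
    witness⇔qWtn X∈S = mk⇔ (to X X∈S) (from X)
      where
      W : Symbol → Set₁
      W Y = Σ[ C ∈ C⊓u ] Σ[ c ∈ N_I ] Σ[ t ∈ Tree ]
        (Point Y c t × qDiff (_∈ S) T₁ T₂ (abox Y) (assertionQuery C c) [])
      to : ∀ Y → Y ∈ S → W Y → qWtnˡʰˢ a b (_∈ S) T₁ T₂ Y
      to (inj₁ A) A∈ (C , _ , _ , at-a , diff) = A∈ , C , diff
      to (inj₂ r) r∈ (C , _ , _ , at-a , diff) = r∈ , C , a , inj₁ refl , diff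
      to (inj₂ r) r∈ (C , _ , _ , at-b , diff) = r∈ , C , b , inj₂ refl , diff
      from : ∀ Y → qWtnˡʰˢ a b (_∈ S) T₁ T₂ Y → W Y
      from (inj₁ A) (_ , C , diff)                  = C , a , _ , at-a , diff
      from (inj₂ r) (_ , C , _ , inj₁ refl , diff) = C , a , _ , at-a , diff
      from (inj₂ r) (_ , C , _ , inj₂ refl , diff) = C , b , _ , at-b , diff

  decision⇔qWtn : ∀ T₁ T₂ S U → Closed U → ∀ X →
    ((ρ₀ ∙ encEL (rootConcept X)) ∙ encInput (T₁ , T₂ , S)) ∈ᵗ U → X ∈ S →
    Meaning decide′ (environment (rootTree X) (b-tree X)
      (encList encInclusion T₁) (encList encInclusion T₂) (encSymbols S) U) ⇔
    qWtnˡʰˢ a b (_∈ S) T₁ T₂ X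
  decision⇔qWtn T₁ T₂ S U U-closed X seed∈ X∈S
    = mk⇔
      (λ m → Equivalence.to qWtn (Equivalence.to decide m))
      (λ w → Equivalence.from decide (Equivalence.from qWtn w))
    where
    root∈ = proj₁ (U-closed seed∈)
    inp∈ = proj₂ (U-closed seed∈)
    T₁∈ = proj₁ (U-closed inp∈)
    T₂∈ = proj₁ (U-closed (proj₂ (U-closed inp∈)))
    S∈ = proj₂ (U-closed (proj₂ (U-closed inp∈)))
    decide = decide-correct T₁ T₂ S U U-closed T₁∈ T₂∈ S∈ X (U-closed root∈) X∈S
    qWtn   = witness⇔qWtn T₁ T₂ S U U-closed T₁∈ T₂∈ S∈ X (U-closed root∈) X∈S

test′ : Formula
test′ = decide′ [ setup′ ]′

setup-sem : ∀ x t₁ t₂ s → let ρ = x ∙ (t₁ ∙ (t₂ ∙ s)) in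
  sem setup′ ρ ≡ environment (sem root′ ρ) (sem b′ ρ) t₁ t₂ s
                             (subtrees (sem root′ ρ ∙ (t₁ ∙ (t₂ ∙ s))))
setup-sem x t₁ t₂ s = refl

setup-tree : ∀ X e → sem root′ (encSymbol X ∙ e) ≡ ρ₀ ∙ encEL (rootConcept X) ×
                     sem b′ (encSymbol X ∙ e) ≡ b-tree X
setup-tree (inj₁ A) e = refl , refl
setup-tree (inj₂ r) e = refl , refl

setup-symbol : ∀ X t₁ t₂ s → let root = ρ₀ ∙ encEL (rootConcept X) in
  sem setup′ (encSymbol X ∙ (t₁ ∙ (t₂ ∙ s))) ≡
  environment root (b-tree X) t₁ t₂ s (subtrees (root ∙ (t₁ ∙ (t₂ ∙ s))))
setup-symbol X t₁ t₂ s = trans (setup-sem (encSymbol X) t₁ t₂ s)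
  (cong₂ (λ root b → environment root b t₁ t₂ s (subtrees (root ∙ (t₁ ∙ (t₂ ∙ s)))))
    (proj₁ (setup-tree X (t₁ ∙ (t₂ ∙ s)))) (proj₂ (setup-tree X (t₁ ∙ (t₂ ∙ s)))))

filterᵗ-enc : ∀ {A : Set} (φ : Formula) (enc : A → Tree) e xs →
  filterᵗ φ e (encList enc xs) ≡ encList enc (filter (λ x → Meaning? φ (enc x ∙ e)) xs)
filterᵗ-enc φ enc e []       = refl
filterᵗ-enc φ enc e (x ∷ xs) with Meaning? φ (enc x ∙ e)
... | yes p = trans (filterᵗ-yes φ (encList enc xs) p) (cong (enc x ∙_) (filterᵗ-enc φ enc e xs))
... | no ¬p = trans (filterᵗ-no φ (encList enc xs) ¬p) (filterᵗ-enc φ enc e xs)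

-- The extra constant pays for `main`, which builds the code of f from its quotation before calling
-- the interpreter.
Fn-polynomial : (f : Fn) → Σ[ p ∈ Program ] Σ[ c ∈ ℕ ] Σ[ d ∈ ℕ ] (∀ x → Σ[ k ∈ ℕ ]
  (p on x returns sem f x within k × k + size (sem f x) ≤ c * size x ^ d))
Fn-polynomial f with c , d , poly ← ⟪⟫-monomial (K (2 + size (code f)) ⊕ bound f) =
  interpreter (code f) , c , d , λ x →
    let k  , r  , k≤  = runs f (code f) x
        k′ , r′ , k′≤ = Machine.run-main (code f) r
    in k′ , r′ , (begin
      k′ + size (sem f x)                         ≤⟨ +-monoˡ-≤ (size (sem f x)) k′≤ ⟩
      2 + size (code f) + k + size (sem f x)      ≡⟨ +-assoc (2 + size (code f)) k _ ⟩
      2 + size (code f) + (k + size (sem f x))    ≤⟨ +-monoʳ-≤ (2 + size (code f)) k≤ ⟩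
      2 + size (code f) + ⟪ bound f ⟫ (size x)    ≤⟨ poly (size x) {{size-nonZero x}} ⟩
      c * size x ^ d                              ∎)
  where
  open ≤-Reasoning
  size-nonZero : ∀ x → NonZero (size x)
  size-nonZero nil     = _
  size-nonZero (_ ∙ _) = _

Fn⇒PolynomialTime : ∀ {ℓ₁ ℓ₂} {X Y : Set} {inp : X → Tree} {out : Y → Tree}
  {Admissible : X → Set ℓ₁} {Spec : X → Y → Set ℓ₂} (f : Fn) (g : X → Y) →
  (∀ x → sem f (inp x) ≡ out (g x)) → (∀ x → Spec x (g x)) →
  PolynomialTime inp out Admissible Spec
Fn⇒PolynomialTime {inp = inp} {out} f g f≡g spec with p , c , d , result ← Fn-polynomial f =
  p , c , d , λ x _ →
    let k , r , k≤ = result (inp x) in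
    g x , k ,
    subst (λ t → p on inp x returns t within k) (f≡g x) r ,
    subst (λ t → k + size t ≤ c * size (inp x) ^ d) (f≡g x) k≤ ,
    spec x

main′ : Fn
main′ = filter′ test′ ∘′ ((tail′ ∘′ tail′) ∙′ id′)

theorem66 : (a b : N_I) → a ≢ b →
    PolynomialTime encInput encSymbols
    (λ (T₁ , T₂ , S) → IsNormalisedTerminology T₁ × IsNormalisedTerminology T₂)
    (λ (T₁ , T₂ , S) W → ∀ X → (X ∈ W) ⇔ qWtnˡʰˢ a b (_∈ S) T₁ T₂ X)
theorem66 a b a≢b = Fn⇒PolynomialTime main′ answer
  (λ x@(_ , _ , S) → filterᵗ-enc test′ encSymbol (encInput x) S)
  (λ x X → mk⇔ (to x X) (from x X))
  where
  open Correctness a b a≢b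

  chosen? : ∀ x X → Dec (Meaning test′ (encSymbol X ∙ encInput x))
  chosen? x X = Meaning? test′ (encSymbol X ∙ encInput x)

  answer : Input → List Symbol
  answer x@(_ , _ , S) = filter (chosen? x) S

  correct′ : ∀ T₁ T₂ S X → X ∈ S → Meaning test′ (encSymbol X ∙ encInput (T₁ , T₂ , S)) ⇔
             qWtnˡʰˢ a b (_∈ S) T₁ T₂ X
  correct′ T₁ T₂ S X X∈S = mk⇔
    (λ m → Equivalence.to decision (subst (Meaning decide′) setup m))
    (λ w → subst (Meaning decide′) (sym setup) (Equivalence.from decision w))
    where
    seed = (ρ₀ ∙ encEL (rootConcept X)) ∙ encInput (T₁ , T₂ , S)
    setup = setup-symbol X (encList encInclusion T₁) (encList encInclusion T₂) (encSymbols S)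
    decision = decision⇔qWtn T₁ T₂ S (subtrees seed) (subtrees-closed seed) X (subtrees-refl seed) X∈S

  to : ∀ ((T₁ , T₂ , S) : Input) X → X ∈ answer (T₁ , T₂ , S) → qWtnˡʰˢ a b (_∈ S) T₁ T₂ X
  to x@(T₁ , T₂ , S) X X∈ with X∈S , m ← ∈-filter⁻ (chosen? x) {xs = S} X∈ =
    Equivalence.to (correct′ T₁ T₂ S X X∈S) m

  qWtn-∈ : ∀ T₁ T₂ S X → qWtnˡʰˢ a b (_∈ S) T₁ T₂ X → X ∈ S
  qWtn-∈ T₁ T₂ S (inj₁ A) = proj₁
  qWtn-∈ T₁ T₂ S (inj₂ r) = proj₁

  from : ∀ ((T₁ , T₂ , S) : Input) X → qWtnˡʰˢ a b (_∈ S) T₁ T₂ X → X ∈ answer (T₁ , T₂ , S)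
  from x@(T₁ , T₂ , S) X w with X∈S ← qWtn-∈ T₁ T₂ S X w =
    ∈-filter⁺ (chosen? x) X∈S (Equivalence.from (correct′ T₁ T₂ S X X∈S) w)
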